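{- Let $n \ge 4$ and let $f \colon \mathbb{Z}_3^n \to \mathbb{Z}_3$ be a function depending on all of its $n$ variables. Then $\operatorname{gap} f = 2$ if and only if there exist a unary polynomial $p(x) = ax^2 + bx + c \in \mathbb{Z}_3[x]$ and a constant $d \in \mathbb{Z}_3$ such that for all $\mathbf{x} = (x_1,\dots,x_n) \in \mathbb{Z}_3^n$: \begin{align*} f(\mathbf{x}) &= \bigoplus_{1 \le i < j \le n} \bigl( (x_i - x_j)^2 p(x_i + x_j) + d \bigr) \oplus d && \text{if } n \equiv 0 \pmod 4,\\ f(\mathbf{x}) &= \bigoplus_{1 \le i < j \le n} \bigl( (x_i - x_j)^2 p(x_i + x_j) + d \bigr) \oplus \bigoplus_{i=1}^n \bigl( p(x_i) + d \bigr) && \text{if } n \equiv 1 \pmod 4,\\ f(\mathbf{x}) &= \bigoplus_{1 \le i < j \le n} \bigl( (x_i - x_j)^2 p(x_i + x_j) + d \bigr) && \text{if } n \equiv 2 \pmod 4,\\ f(\mathbf{x}) &= \bigoplus_{1 \le i < j \le n} \bigl( (x_i - x_j)^2 p(x_i + x_j) + d \bigr) \oplus \bigoplus_{i=1}^n \bigl( p(x_i) + d \bigr) \oplus d && \text{if } n \equiv 3 \pmod 4; \end{align*} moreover, in that case $p$ (i.e. $a,b,c$) and $d$ are uniquely determined by $f$. Otherwise $\operatorname{gap} f = 1$.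
   Context: $+$, $-$ and multiplication are the field operations of $\mathbb{Z}_3 = \{0,1,2\}$. Each element $u \in \mathbb{Z}_3$ is identified with the singleton $\{u\}$ in the Boolean group $(\mathcal{P}(\mathbb{Z}_3); \oplus)$, where $\oplus$ is symmetric difference of sets; the expressions inside the parentheses are computed in $\mathbb{Z}_3$ and the results are combined with $\oplus$ (the equalities are asserted in $\mathcal{P}(\mathbb{Z}_3)$, where $f(\mathbf{x})$ is identified with $\{f(\mathbf{x})\}$). The $i$-th variable of $g \colon \mathbb{Z}_3^n \to \mathbb{Z}_3$ is essential if there are tuples differing only in the $i$-th coordinate on which $g$ takes different values; $\operatorname{Ess} g$ is the set of indices of essential variables and $\operatorname{ess} g = |\operatorname{Ess} g|$. For $i \ne j$, the identification minor $f_{i \leftarrow j}$ is $f_{i \leftarrow j}(x_1,\dots,x_n) = f(x_1,\dots,x_{i-1},x_j,x_{i+1},\dots,x_n)$. The arity gap of $f$ is $\operatorname{gap} f = \min_{i,j \in \operatorname{Ess} f,\, i \ne j} (\operatorname{ess} f - \operatorname{ess} f_{i \leftarrow j})$. -}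

module Defs where

open import Data.Nat as ℕ using (ℕ; zero; suc; _∸_; _⊓_)
open import Data.Fin using (Fin; toℕ; _≟_)
open import Data.Fin.Properties using (any?)
open import Data.Fin.Subset using (Subset; ⁅_⁆; ∣_∣; ⊥)
open import Data.Bool using (Bool; true; false; _xor_; _∧_; if_then_else_)
open import Data.Vec using (Vec; []; _∷_; _[_]≔_; lookup; tabulate; zipWith)
open import Data.List as List using (List; concatMap; foldr; allFin)
open import Data.Product using (Σ; ∃; _,_; _×_)
open import Relation.Nullary using (Dec; yes; no; ¬_; does; ¬?)
open import Relation.Binary.PropositionalEquality using (_≡_; _≢_)
open import Data.Nat.DivMod using (_mod_; _%_)

Z3 : Set
Z3 = Fin 3

infixl 6 _+₃_ _-₃_
infixl 7 _*₃_

_+₃_ : Z3 → Z3 → Z3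
x +₃ y = (toℕ x ℕ.+ toℕ y) mod 3

_*₃_ : Z3 → Z3 → Z3
x *₃ y = (toℕ x ℕ.* toℕ y) mod 3

-₃_ : Z3 → Z3
-₃ x = (3 ∸ toℕ x) mod 3

_-₃_ : Z3 → Z3 → Z3
x -₃ y = x +₃ (-₃ y)

poly : Z3 → Z3 → Z3 → Z3 → Z3
poly a b c x = a *₃ (x *₃ x) +₃ b *₃ x +₃ c

infixl 5 _⊕_
_⊕_ : Subset 3 → Subset 3 → Subset 3
_⊕_ = zipWith _xor_

⊕-single : ∀ {n} → (Z3 → Subset 3) → Vec Z3 n → Subset 3
⊕-single g [] = ⊥
⊕-single g (x ∷ xs) = g x ⊕ ⊕-single g xs

⊕-pairs : ∀ {n} → (Z3 → Z3 → Subset 3) → Vec Z3 n → Subset 3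
⊕-pairs g [] = ⊥
⊕-pairs g (x ∷ xs) = ⊕-single (g x) xs ⊕ ⊕-pairs g xs

Tuple : ℕ → Set
Tuple n = Vec Z3 n

Essential : ∀ {n} → (Tuple n → Z3) → Fin n → Set
Essential f i = ∃ λ x → ∃ λ (a : Z3) → f x ≢ f (x [ i ]≔ a)

∃Tuple? : ∀ {k} n {P : Vec (Fin k) n → Set} → (∀ x → Dec (P x)) → Dec (∃ P)
∃Tuple? zero P? with P? []
... | yes p = yes ([] , p)
... | no ¬p = no λ { ([] , p) → ¬p p }
∃Tuple? (suc n) {P} P? with any? (λ a → ∃Tuple? n (λ xs → P? (a ∷ xs)))
... | yes (a , xs , p) = yes (a ∷ xs , p)
... | no ¬p = no λ { (a ∷ xs , p) → ¬p (a , xs , p) }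

essential? : ∀ {n} (f : Tuple n → Z3) (i : Fin n) → Dec (Essential f i)
essential? {n} f i = ∃Tuple? n (λ x → any? (λ a → ¬? (f x ≟ f (x [ i ]≔ a))))

Ess : ∀ {n} → (Tuple n → Z3) → Subset n
Ess f = tabulate (λ i → does (essential? f i))

ess : ∀ {n} → (Tuple n → Z3) → ℕ
ess f = ∣ Ess f ∣

minor : ∀ {n} → (Tuple n → Z3) → Fin n → Fin n → (Tuple n → Z3)
minor f i j x = f (x [ i ]≔ lookup x j)

-- minimum of a list of naturals (0 for the empty list; never used here)
minimum : List ℕ → ℕ
minimum List.[] = 0
minimum (x List.∷ xs) = foldr _⊓_ x xs

gapValues : ∀ {n} → (Tuple n → Z3) → List ℕ
gapValues {n} f =
  concatMap (λ i → concatMap (λ j →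
     if does (i ≟ j) then List.[]
     else (if does (essential? f i) ∧ does (essential? f j)
           then List.[ ess f ∸ ess (minor f i j) ] else List.[]))
     (allFin n)) (allFin n)

gap : ∀ {n} → (Tuple n → Z3) → ℕ
gap f = minimum (gapValues f)

pairTerm : Z3 → Z3 → Z3 → Z3 → Z3 → Z3 → Subset 3
pairTerm a b c d xi xj = ⁅ (xi -₃ xj) *₃ (xi -₃ xj) *₃ poly a b c (xi +₃ xj) +₃ d ⁆

singleTerm : Z3 → Z3 → Z3 → Z3 → Z3 → Subset 3
singleTerm a b c d xi = ⁅ poly a b c xi +₃ d ⁆

HasForm : ∀ n → (Tuple n → Z3) → Z3 → Z3 → Z3 → Z3 → Set
HasForm n f a b c d = ∀ (x : Tuple n) →
    (n % 4 ≡ 0 → ⁅ f x ⁆ ≡ ⊕-pairs (pairTerm a b c d) x ⊕ ⁅ d ⁆)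
  × (n % 4 ≡ 1 → ⁅ f x ⁆ ≡ ⊕-pairs (pairTerm a b c d) x ⊕ ⊕-single (singleTerm a b c d) x)
  × (n % 4 ≡ 2 → ⁅ f x ⁆ ≡ ⊕-pairs (pairTerm a b c d) x)
  × (n % 4 ≡ 3 → ⁅ f x ⁆ ≡ ⊕-pairs (pairTerm a b c d) x ⊕ ⊕-single (singleTerm a b c d) x ⊕ ⁅ d ⁆)

{-# OPTIONS --safe #-}
-- If gap f ≥ 2, then every minor f_{i ← j} loses, besides x_i, either the merged variable x_j (the pair
-- is "good") or some x_u with u ≠ j (then u is "removable" for the pair). All pairs are good: suppose that
-- {p, q} is not, and that u is removable for it. By well-founded induction on the set of removable
-- variables, each of {p, u} and {q, u} is good or loses the third variable, so on x_p = x_q, x_p = x_u and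
-- x_q = x_u the function is determined by its restriction g to x_p = x_q, evaluated at x_p or at x_q. A
-- fourth variable excludes all patterns except a projection, and since among four elements of Z3 two
-- coincide, the projection pattern makes x_u inessential, a contradiction.
-- When all pairs are good, f is invariant under permutations (again because two of four entries coincide)
-- and under replacing an equal pair of entries by another one, so f x depends only on the set of values
-- occurring an odd number of times in x. There are four such sets for each parity of n, which matches the
-- freedom in choosing p and d. Conversely, such an f loses exactly two variables in the minor x_0 = x_1.
module Submission where

open import Defs
open import Data.Bool as Bool using (Bool; true; false; not; if_then_else_; _∧_; _xor_)
open import Data.Empty using (⊥; ⊥-elim)
open import Data.Nat as ℕ using (ℕ; zero; suc; _≤_; s≤s; z≤n; _<_; _∸_; _⊓_)
open import Data.Fin using (Fin; zero; suc; _≟_; toℕ)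
open import Data.Fin.Patterns using (0F; 1F; 2F; 3F)
open import Data.Fin.Properties using (any?; all?; pigeonhole; toℕ-injective; suc-injective)
open import Data.Fin.Subset using (Subset; _∈_; _⊂_; ⁅_⁆; _⊆_; ∣_∣; ∁) renaming (⊥ to ∅; ⊤ to full)
open import Data.Fin.Subset.Induction using (⊂-wellFounded)
open import Data.Product using (Σ; ∃; _,_; _×_; proj₁; proj₂)
open import Data.Sum as Sum using (_⊎_; inj₁; inj₂; [_,_]′)
open import Data.Vec using (Vec; []; _∷_; _[_]≔_; lookup; tabulate)
open import Data.Vec.Properties using (lookup∘update; lookup∘update′; lookup∘tabulate; []=⇒lookup; lookup⇒[]=; ≡-dec; zipWith-comm; zipWith-assoc; zipWith-identityˡ; zipWith-identityʳ; tabulate∘lookup; tabulate-cong; []≔-idempotent)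
open import Data.Vec.Relation.Unary.All using ([]; _∷_)
open import Data.Vec.Relation.Unary.AllPairs using ([]; _∷_)
open import Data.Vec.Relation.Unary.Unique.Propositional using (Unique)
open import Data.Vec.Relation.Unary.Unique.Propositional.Properties using (lookup-injective)
open import Function using (_∘_; id)
open import Induction.WellFounded using (Acc; acc)
open import Relation.Nullary using (Dec; yes; no; ¬_; does; ¬?; contradiction)
open import Relation.Nullary.Decidable using (_×-dec_; _⊎-dec_; toWitness; decidable-stable; dec-true; map′; _→-dec_; dec-false)
open import Relation.Binary.PropositionalEquality
open import Data.Bool.Properties using (xor-comm; xor-assoc; xor-identityˡ; xor-identityʳ; xor-same)
open import Data.Nat.DivMod using (_%_)
open import Data.Fin.Subset.Properties using (x∈⁅x⁆; x∈⁅y⁆⇒x≡y; ∣⊤∣≡n; ∣p∣≤n; ∣⁅x⁆∣≡1; ∣∁p∣≡n∸∣p∣; x∉p⇒x∈∁p; x∈∁p⇒x∉p; p⊆q⇒∣p∣≤∣q∣; p⊂q⇒∣p∣<∣q∣; ∣p∣≤∣x∷p∣; drop-there; ∈⊤)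
open import Data.Maybe using (Maybe; just; nothing; maybe)
open import Data.Product.Properties using () renaming (≡-dec to ×-≡-dec)
open import Data.Nat.Properties using (≤-trans; ≤-refl; ≤-reflexive; ≤-antisym; ≮⇒≥; m≤n+m∸n; m≤n+o⇒m∸n≤o; m+n≤o⇒m≤o∸n; m⊓n≤m; m⊓n≤n; ⊓-sel; +-comm)
open import Data.List as List using (List; allFin; foldr; concatMap)
open import Data.List.Membership.Propositional using (lose; find) renaming (_∈_ to _∈ˡ_)
open import Data.List.Membership.Propositional.Properties using (∈-concatMap⁺; ∈-concatMap⁻; ∈-allFin; foldr-selective)
open import Data.List.Relation.Unary.Any using (here; there)
open import Function.Bundles using (_⇔_; mk⇔)

-- Decidable subsets and pigeonhole arguments.

select : ∀ {n} {P : Fin n → Set} → (∀ i → Dec (P i)) → Subset n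
select P? = tabulate (λ i → does (P? i))

module _ {n} {P : Fin n → Set} (P? : ∀ i → Dec (P i)) where

  ∈-select : ∀ {i} → P i → i ∈ select P?
  ∈-select {i} p = lookup⇒[]= i _ (trans (lookup∘tabulate _ i) (dec-true (P? i) p))

  select-∈ : ∀ {i} → i ∈ select P? → P i
  select-∈ {i} m with P? i | trans (sym (lookup∘tabulate (λ k → does (P? k)) i)) ([]=⇒lookup m)
  ... | yes p | _ = p
  ... | no _ | ()

coincidence : ∀ (x y z w : Z3) → x ≡ y ⊎ z ≡ x ⊎ z ≡ y ⊎ w ≡ x ⊎ w ≡ y ⊎ w ≡ z
coincidence = toWitness {a? = all? λ x → all? λ y → all? λ z → all? λ w →
  (x ≟ y) ⊎-dec (z ≟ x) ⊎-dec (z ≟ y) ⊎-dec (w ≟ x) ⊎-dec (w ≟ y) ⊎-dec (w ≟ z)} _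

module _ {n : ℕ} where

  -- If every index were one of `p`, `q`, `u`, recording which one would map `Fin n` injectively
  -- into `Fin 3`.
  fresh : 4 ≤ n → (p q u : Fin n) → ∃ λ v → v ≢ p × v ≢ q × v ≢ u
  fresh 4≤n p q u with any? (λ v → ¬? (v ≟ p) ×-dec ¬? (v ≟ q) ×-dec ¬? (v ≟ u))
  ... | yes v = v
  ... | no none = contradiction (pigeonhole 4≤n index) λ (i , j , i<j , eq) →
          <⇒≢ i<j (trans (index-lookup i) (trans (cong (lookup pqu) eq) (sym (index-lookup j))))
    where
    open import Data.Fin.Properties using (<⇒≢)
    pqu = p ∷ q ∷ u ∷ []
    position : ∀ i → ∃ λ k → i ≡ lookup pqu k
    position i with i ≟ p | i ≟ q | i ≟ u
    ... | yes e | _ | _ = 0F , e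
    ... | no _ | yes e | _ = 1F , e
    ... | no _ | no _ | yes e = 2F , e
    ... | no a | no b | no c = ⊥-elim (none (i , a , b , c))
    index : Fin n → Fin 3
    index = proj₁ ∘ position
    index-lookup : ∀ i → i ≡ lookup pqu (index i)
    index-lookup = proj₂ ∘ position

  distinct₄ : ∀ {i j k l : Fin n} → i ≢ j → i ≢ k → i ≢ l → j ≢ k → j ≢ l → k ≢ l → Unique (i ∷ j ∷ k ∷ l ∷ [])
  distinct₄ a b c d e f = (a ∷ b ∷ c ∷ []) ∷ (d ∷ e ∷ []) ∷ (f ∷ []) ∷ [] ∷ []

  -- Assignments and agreement outside a set of coordinates.

  Assignment : Set
  Assignment = Fin n → Z3

  infix 4 _≈[_]_
  _≈[_]_ : Assignment → (Fin n → Set) → Assignment → Set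
  x ≈[ S ] y = ∀ m → S m ⊎ x m ≡ y m

  set : Assignment → Fin n → Z3 → Assignment
  set x i a m = if does (m ≟ i) then a else x m

  set-same : ∀ x i {a} → set x i a i ≡ a
  set-same x i with i ≟ i
  ... | yes _ = refl
  ... | no i≢i = contradiction refl i≢i

  set-other : ∀ x {i a m} → m ≢ i → set x i a m ≡ x m
  set-other x {i} {m = m} m≢i with m ≟ i
  ... | yes m≡i = contradiction m≡i m≢i
  ... | no _ = refl

  set-≈ : ∀ x {i a} → x ≈[ _≡ i ] set x i a
  set-≈ x {i} m with m ≟ i
  ... | yes m≡i = inj₁ m≡i
  ... | no _ = inj₂ refl

  ≈-set : ∀ {S x y i a} → x ≈[ S ] y → set x i a ≈[ S ] set y i a
  ≈-set {i = i} r m with m ≟ i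
  ... | yes _ = inj₂ refl
  ... | no _ = r m

  ≈-sym : ∀ {S x y} → x ≈[ S ] y → y ≈[ S ] x
  ≈-sym r m = [ inj₁ , inj₂ ∘ sym ]′ (r m)

  ≈-at : ∀ {S x y i} → x ≈[ S ] y → ¬ S i → x i ≡ y i
  ≈-at {i = i} r ¬s = [ (λ s → contradiction s ¬s) , id ]′ (r i)

-- Variables lost when two coordinates are identified.

module Minors {n : ℕ} (F : (Fin n → Z3) → Z3)
           (F-cong : ∀ {x y} → (∀ m → x m ≡ y m) → F x ≡ F y) where

  -- For S = {l} or S = {i , j} this says that the minor F_{i ← j} depends on no variable in S.
  Invariant : Fin n → Fin n → (Fin n → Set) → Set
  Invariant i j S = ∀ {x y} → x i ≡ x j → y i ≡ y j → x ≈[ S ] y → F x ≡ F y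

  Indep : Fin n → Fin n → Fin n → Set
  Indep i j l = Invariant i j (_≡ l)

  Good : Fin n → Fin n → Set
  Good i j = Invariant i j (λ m → m ≡ i ⊎ m ≡ j)

  Dead : Fin n → Set
  Dead l = ∀ {x y} → x ≈[ _≡ l ] y → F x ≡ F y

  Loses : Fin n → Fin n → Set
  Loses i j = Good i j ⊎ ∃ λ l → l ≢ i × l ≢ j × Indep i j l

  Indep-sym : ∀ {i j l} → Indep i j l → Indep j i l
  Indep-sym I ex ey = I (sym ex) (sym ey)

  Good-sym : ∀ {i j} → Good i j → Good j i
  Good-sym G ex ey r = G (sym ex) (sym ey) (λ m → [ inj₁ ∘ [ inj₂ , inj₁ ]′ , inj₂ ]′ (r m))

  -- On `x p = x q` the entry at `u` is free by `I`. Move it to `x p`, change the entry at `w` by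
  -- `J`, then move it back.
  Indep-trans : ∀ {p q u w} → u ≢ p → u ≢ q → w ≢ u → w ≢ p →
                Indep p q u → Indep p u w → Indep p q w
  Indep-trans {p} {q} {u} {w} u≢p u≢q w≢u w≢p I J {x} {y} ex ey r = begin
    F x                ≡⟨ I ex (moved x ex) (set-≈ x) ⟩
    F (set x u (x p))  ≡⟨ J (merged x) merged-y (≈-set r) ⟩
    F (set y u (x p))  ≡⟨ I (moved y ey) ey (≈-sym (set-≈ y)) ⟩
    F y                ∎
    where
    open ≡-Reasoning
    moved : ∀ z {a} → z p ≡ z q → set z u a p ≡ set z u a q
    moved z e = trans (set-other z (u≢p ∘ sym)) (trans e (sym (set-other z (u≢q ∘ sym))))
    merged : ∀ z → set z u (z p) p ≡ set z u (z p) u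
    merged z = trans (set-other z (u≢p ∘ sym)) (sym (set-same z u))
    merged-y : set y u (x p) p ≡ set y u (x p) u
    merged-y = trans (set-other y (u≢p ∘ sym))
      (trans (sym (≈-at r (w≢p ∘ sym))) (sym (set-same y u)))

  -- Evaluation at finitely many named coordinates.

  module Coordinates {k} (c : Fin k → Fin n) (c-inj : ∀ {i j} → c i ≡ c j → i ≡ j) where

    -- The vector overrides `o` at the named coordinates. With literal vectors, equalities between
    -- entries hold by `refl`.
    env : (Fin n → Z3) → Vec Z3 k → Fin n → Z3
    env o a m with any? (λ i → c i ≟ m)
    ... | yes (i , _) = lookup a i
    ... | no _ = o m

    env-at : ∀ o a i → env o a (c i) ≡ lookup a i
    env-at o a i with any? (λ j → c j ≟ c i)
    ... | yes (j , e) = cong (lookup a) (c-inj e)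
    ... | no none = contradiction (i , refl) none

    env-off : ∀ o a {m} → (∀ i → c i ≢ m) → env o a m ≡ o m
    env-off o a {m} m∉ with any? (λ i → c i ≟ m)
    ... | yes (i , e) = contradiction e (m∉ i)
    ... | no _ = refl

    env-≈ : ∀ {S o o′ a b} → (∀ i → S (c i) ⊎ lookup a i ≡ lookup b i) →
            (∀ m → (∀ i → c i ≢ m) → S m ⊎ o m ≡ o′ m) → env o a ≈[ S ] env o′ b
    env-≈ {S} ab oo m with any? (λ i → c i ≟ m)
    ... | yes (i , refl) = ab i
    ... | no none = oo m (λ i e → none (i , e))

    at : (Fin n → Z3) → Vec Z3 k → Z3
    at o a = F (env o a)

    at-self : ∀ {x a} → (∀ i → x (c i) ≡ lookup a i) → F x ≡ at x a
    at-self {x} {a} e = F-cong λ m → go m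
      where
      go : ∀ m → x m ≡ env x a m
      go m with any? (λ i → c i ≟ m)
      ... | yes (i , refl) = e i
      ... | no _ = refl

    at-eq : ∀ {o a} i j → lookup a i ≡ lookup a j → env o a (c i) ≡ env o a (c j)
    at-eq {o} {a} i j e = trans (env-at o a i) (trans e (sym (env-at o a j)))

    -- For literal indices the updated vector computes, so chains of such equalities rewrite
    -- explicit tuples.
    at-good : ∀ i j → Good (c i) (c j) → ∀ o a s → lookup a i ≡ lookup a j →
              at o a ≡ at o (a [ i ]≔ s [ j ]≔ s)
    at-good i j G o a s e = G (at-eq i j e) (at-eq i j both) (env-≈ change λ m _ → inj₂ refl)
      where
      both : lookup (a [ i ]≔ s [ j ]≔ s) i ≡ lookup (a [ i ]≔ s [ j ]≔ s) j
      both with i ≟ j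
      ... | yes refl = refl
      ... | no i≢j = trans (lookup∘update′ i≢j (a [ i ]≔ s) s)
                       (trans (lookup∘update i a s) (sym (lookup∘update j (a [ i ]≔ s) s)))
      change : ∀ l → (c l ≡ c i ⊎ c l ≡ c j) ⊎ lookup a l ≡ lookup (a [ i ]≔ s [ j ]≔ s) l
      change l with l ≟ i | l ≟ j
      ... | yes refl | _ = inj₁ (inj₁ refl)
      ... | no _ | yes refl = inj₁ (inj₂ refl)
      ... | no l≢i | no l≢j = inj₂ (sym (trans (lookup∘update′ l≢j (a [ i ]≔ s) s) (lookup∘update′ l≢i a s)))

    at-indep : ∀ i j l → l ≢ i → l ≢ j → Indep (c i) (c j) (c l) → ∀ o a s →
               lookup a i ≡ lookup a j → at o a ≡ at o (a [ l ]≔ s)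
    at-indep i j l l≢i l≢j I o a s e = I (at-eq i j e)
      (at-eq i j (trans (lookup∘update′ (l≢i ∘ sym) a s) (trans e (sym (lookup∘update′ (l≢j ∘ sym) a s)))))
      (env-≈ change λ m _ → inj₂ refl)
      where
      change : ∀ m → c m ≡ c l ⊎ lookup a m ≡ lookup (a [ l ]≔ s) m
      change m with m ≟ l
      ... | yes refl = inj₁ refl
      ... | no m≢l = inj₂ (sym (lookup∘update′ m≢l a s))

    at-indep-off : ∀ i j {t} → Indep (c i) (c j) t → ∀ {o o′} a → o ≈[ _≡ t ] o′ →
                   lookup a i ≡ lookup a j → at o a ≡ at o′ a
    at-indep-off i j I a r e = I (at-eq i j e) (at-eq i j e) (env-≈ (λ _ → inj₂ refl) λ m _ → r m)

    at-cong : ∀ {o o′} a → (∀ m → (∀ i → c i ≢ m) → o m ≡ o′ m) → at o a ≡ at o′ a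
    at-cong a e = F-cong λ m → [ ⊥-elim , id ]′ (env-≈ {S = λ _ → ⊥} (λ _ → inj₂ refl) (λ m m∉ → inj₂ (e m m∉)) m)

  -- Four coordinates, with `u` removable for the pair `p`, `q`.

  module Quad {p q u v : Fin n} (p≢q : p ≢ q) (u≢p : u ≢ p) (u≢q : u ≢ q)
              (v≢p : v ≢ p) (v≢q : v ≢ q) (v≢u : v ≢ u) (H : Indep p q u) where

    c : Fin 4 → Fin n
    c = lookup (p ∷ q ∷ u ∷ v ∷ [])

    open Coordinates c (lookup-injective (distinct₄ p≢q (u≢p ∘ sym) (v≢p ∘ sym) (u≢q ∘ sym) (v≢q ∘ sym) (v≢u ∘ sym)) _ _) public

    value : Assignment → Z3 → Z3 → Z3 → Z3 → Z3
    value o x y z w = at o (x ∷ y ∷ z ∷ w ∷ [])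

    -- The restriction to `x p = x q`. By `H` the entry at `u` is irrelevant there and is set to `x`
    -- by convention.
    g : Assignment → Z3 → Z3 → Z3
    g o x w = value o x x x w

    diag : ∀ o x z w → value o x x z w ≡ g o x w
    diag o x z w = at-indep 0F 1F 2F (λ ()) (λ ()) H o _ x refl

    self : ∀ X → F X ≡ value X (X p) (X q) (X u) (X v)
    self X = at-self λ { 0F → refl ; 1F → refl ; 2F → refl ; 3F → refl }

    reduce : ∀ {X} → X p ≡ X q → F X ≡ g X (X p) (X v)
    reduce {X} e = trans (self X) (trans (cong (λ y → value X (X p) y (X u) (X v)) (sym e)) (diag _ _ _ _))

    Off : Fin n → Set
    Off t = t ≢ p × t ≢ q × t ≢ u × t ≢ v

    -- By `reduce`, the merged variable of the pair enters only through the first argument of `g`.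
    good-pq : (∀ o x y w → g o x w ≡ g o y w) → Good p q
    good-pq h {X} {Y} ex ey r = trans (reduce ex) (trans (h X (X p) (Y p) (X v))
      (trans (cong (g X (Y p)) (≈-at r λ { (inj₁ e) → v≢p e ; (inj₂ e) → v≢q e }))
      (trans (at-cong _ λ m m∉ → ≈-at r λ { (inj₁ e) → m∉ 0F (sym e) ; (inj₂ e) → m∉ 1F (sym e) })
      (sym (reduce ey)))))

    indep-v : (∀ o x w w′ → g o x w ≡ g o x w′) → Indep p q v
    indep-v h {X} {Y} ex ey r = trans (reduce ex) (trans (h X (X p) (X v) (Y v))
      (trans (cong (λ x → g X x (Y v)) (≈-at r (v≢p ∘ sym)))
      (trans (at-cong _ λ m m∉ → ≈-at r λ e → m∉ 3F (sym e)) (sym (reduce ey)))))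

    indep-t : ∀ {t} → Off t → (∀ {o o′} x w → o ≈[ _≡ t ] o′ → g o x w ≡ g o′ x w) → Indep p q t
    indep-t (t≢p , _ , _ , t≢v) h {X} {Y} ex ey r = trans (reduce ex) (trans (h (X p) (X v) r)
      (trans (cong₂ (g Y) (≈-at r (t≢p ∘ sym)) (≈-at r (t≢v ∘ sym))) (sym (reduce ey))))

    indep-v-elim : Indep p q v → ∀ o x w w′ → g o x w ≡ g o x w′
    indep-v-elim I o x w w′ = at-indep 0F 1F 3F (λ ()) (λ ()) I o _ w′ refl

    -- The value at `X` survives overwriting `x q` by `x p` and changing `x u`. The coordinate `v`
    -- is not mentioned, so the property can be passed between different choices of the fourth
    -- coordinate.
    Collapses : Assignment → Set
    Collapses X = ∀ {Y} → Y p ≡ Y q → X ≈[ (λ m → m ≡ q ⊎ m ≡ u) ] Y → F X ≡ F Y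

    collapses : ∀ X → value X (X p) (X q) (X u) (X v) ≡ g X (X p) (X v) → Collapses X
    collapses X h {Y} ey r = trans (self X) (trans h
      (trans (cong₂ (g X) (≈-at r λ { (inj₁ e) → p≢q e ; (inj₂ e) → u≢p (sym e) })
                          (≈-at r λ { (inj₁ e) → v≢q e ; (inj₂ e) → v≢u e }))
      (trans (at-cong _ λ m m∉ → ≈-at r λ { (inj₁ e) → m∉ 1F (sym e) ; (inj₂ e) → m∉ 2F (sym e) })
      (sym (reduce ey)))))

    collapsed : ∀ {o x y z w} → Collapses (env o (x ∷ y ∷ z ∷ w ∷ [])) → value o x y z w ≡ g o x w
    collapsed K = K (at-eq 0F 1F refl)
      (env-≈ (λ { 0F → inj₂ refl ; 1F → inj₁ (inj₁ refl) ; 2F → inj₁ (inj₂ refl) ; 3F → inj₂ refl })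
             λ _ _ → inj₂ refl)

    -- The boolean tells whether, once `u` agrees with `p` (or with `q`), `g` is evaluated at `x p`
    -- (true) or at `x q` (false). Equal booleans on both sides form a projection pattern.
    p-side q-side : Bool → Set
    p-side s = if s then Indep p u q else Good p u
    q-side s = if s then Good q u else Indep q u p

    pick : Bool → Z3 → Z3 → Z3
    pick b x y = if b then x else y

    p-value : ∀ s → p-side s → ∀ o x y w → value o x y x w ≡ g o (pick s x y) w
    p-value true  I o x y w = at-indep 0F 2F 1F (λ ()) (λ ()) I o _ x refl
    p-value false G o x y w = at-good 0F 2F G o _ y refl

    q-value : ∀ s → q-side s → ∀ o x y w → value o x y y w ≡ g o (pick s x y) w
    q-value true  G o x y w = at-good 1F 2F G o _ x refl
    q-value false I o x y w = at-indep 1F 2F 0F (λ ()) (λ ()) I o _ y refl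

    module Contradictions (bad : ¬ Good p q) (no-t : ∀ {t} → Off t → ¬ Indep p q t) (no-v : ¬ Indep p q v) where

      -- Reading `A` at `x v = x p` turns whatever the minor of `p`, `v` loses into a loss of `g`:
      -- the first argument, `v`, or an outside variable. All three are excluded.
      not-mixed : ∀ e → (∀ o x y w → value o x y (pick e x y) w ≡ g o y w) →
                  (∀ o x y w → value o x y (pick (not e) x y) w ≡ g o x w) → ¬ Loses p v
      not-mixed e A B (inj₁ G) = no-v (indep-v λ o x w w′ → trans (h o w x) (sym (h o w′ x)))
        where
        h : ∀ o x y → g o y x ≡ g o y y
        h o x y = trans (sym (A o x y x)) (trans (at-good 0F 3F G o _ y refl) (diag o y _ y))
      not-mixed e A B (inj₂ (l , l≢p , l≢v , I)) with l ≟ q | l ≟ u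
      ... | yes refl | _ = bad (good-pq λ o x y w → trans (h o w x) (sym (h o w y)))
        where
        h : ∀ o x y → g o y x ≡ g o x x
        h o x y = trans (sym (A o x y x)) (trans (at-indep 0F 3F 1F (λ ()) (λ ()) I o _ x refl) (diag o x _ x))
      -- Independence of `u` passes from the coincidence in `A` to the one in `B`, and these
      -- evaluate `g` at different entries.
      ... | no _ | yes refl = bad (good-pq λ o x y w → trans (h o w x) (sym (h o w y)))
        where
        h : ∀ o x y → g o y x ≡ g o x x
        h o x y = trans (sym (A o x y x)) (trans (at-indep 0F 3F 2F (λ ()) (λ ()) I o _ _ refl) (B o x y x))
      ... | no l≢q | no l≢u = no-t off (indep-t off λ {o} {o′} y x r →
              trans (sym (A o x y x)) (trans (at-indep-off 0F 3F I _ r refl) (A o′ x y x)))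
        where
        off : Off l
        off = l≢p , l≢q , l≢u , l≢v

      module _ (P : Indep p u q) (Q : Good q u) where

        -- Where `q`, `u` and `v` all agree, all values of `g` still occur, so any loss other than
        -- `q` would be a forbidden loss of `g`.
        uv-loses-q : Loses u v → Indep u v q
        uv-loses-q (inj₁ G) = ⊥-elim (no-v (indep-v λ o x w w′ → trans (h o x w) (sym (h o x w′))))
          where
          h : ∀ o x w → g o x w ≡ g o x x
          h o x w = trans (sym (q-value true Q o x w w))
            (trans (at-good 2F 3F G o _ x refl) (p-value true P o x w x))
        uv-loses-q (inj₂ (l , l≢u , l≢v , I)) with l ≟ p | l ≟ q
        ... | yes refl | _ = ⊥-elim (bad (good-pq λ o x y w → trans (h o x w) (sym (h o y w))))
          where
          h : ∀ o x w → g o x w ≡ g o w w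
          h o x w = trans (sym (q-value true Q o x w w)) (at-indep 2F 3F 0F (λ ()) (λ ()) I o _ w refl)
        ... | no _ | yes refl = I
        ... | no l≢p | no l≢q = ⊥-elim (no-t (l≢p , l≢q , l≢u , l≢v) (indep-t (l≢p , l≢q , l≢u , l≢v)
          λ {o} {o′} x w r → trans (sym (q-value true Q o x w w))
            (trans (at-indep-off 2F 3F I _ r refl) (q-value true Q o′ x w w))))

        -- The same argument on the tuples with `x u = x p` and `x v = x q`, which also show every
        -- value of `g`.
        qv-loses-u : Loses q v → Indep q v u
        qv-loses-u (inj₁ G) = ⊥-elim (no-v (indep-v λ o x w w′ → trans (h o x w) (sym (h o x w′))))
          where
          h : ∀ o x w → g o x w ≡ g o x x
          h o x w = trans (sym (p-value true P o x w w)) (at-good 1F 3F G o _ x refl)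
        qv-loses-u (inj₂ (l , l≢q , l≢v , I)) with l ≟ p | l ≟ u
        ... | yes refl | _ = ⊥-elim (bad (good-pq λ o x y w → trans (h o x w) (sym (h o y w))))
          where
          h : ∀ o x w → g o x w ≡ g o w w
          h o x w = trans (sym (p-value true P o x w w))
            (trans (at-indep 1F 3F 0F (λ ()) (λ ()) I o _ w refl) (diag o w x w))
        ... | no _ | yes refl = I
        ... | no l≢p | no l≢u = ⊥-elim (no-t (l≢p , l≢q , l≢u , l≢v) (indep-t (l≢p , l≢q , l≢u , l≢v)
          λ {o} {o′} x w r → trans (sym (p-value true P o x w w))
            (trans (at-indep-off 1F 3F I _ r refl) (p-value true P o′ x w w))))

    module Projection (P : Indep p u q) (Q : Good q u) where

      collapses-v≡q : Indep q v u → ∀ {X} → X v ≡ X q → Collapses X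
      collapses-v≡q I {X} e = collapses X (trans (cong (value X (X p) (X q) (X u)) e)
        (trans (at-indep 1F 3F 2F (λ ()) (λ ()) I X _ (X p) refl)
        (trans (p-value true P X (X p) (X q) (X q)) (cong (g X (X p)) (sym e)))))

      -- Each possible loss of the pair `p`, `v` leads back to a known coincidence. A lost outside
      -- variable `l` may be set to `x q`; the coincidence of `l` with `q` then collapses the tuple.
      v≡p-value : Indep u v q → Indep q v u → Loses p v →
                  (∀ {t} → Off t → ∀ {X} → X t ≡ X q → Collapses X) →
                  ∀ o x y z → value o x y z x ≡ g o x x
      v≡p-value J K (inj₁ G) T o x y z = trans (at-good 0F 3F G o _ y refl) (trans (diag o y z y)
        (trans (sym (diag o y x y)) (trans (at-good 0F 3F G o _ x refl) (p-value true P o x y x))))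
      v≡p-value J K (inj₂ (l , l≢p , l≢v , I)) T o x y z with l ≟ q | l ≟ u
      ... | yes refl | _ = trans (at-indep 0F 3F 1F (λ ()) (λ ()) I o _ x refl) (diag o x z x)
      ... | no _ | yes refl = trans (at-indep 0F 3F 2F (λ ()) (λ ()) I o _ x refl) (p-value true P o x y x)
      ... | no l≢q | no l≢u = trans (at-indep-off 0F 3F I _ (set-≈ o) refl)
              (trans (collapsed (T off same)) (sym (at-indep-off 0F 3F I _ (set-≈ o) refl)))
        where
        off : Off l
        off = l≢p , l≢q , l≢u , l≢v
        same : env (set o l y) (x ∷ y ∷ z ∷ x ∷ []) l ≡ env (set o l y) (x ∷ y ∷ z ∷ x ∷ []) q
        same = trans (env-off _ _ λ { 0F → l≢p ∘ sym ; 1F → l≢q ∘ sym ; 2F → l≢u ∘ sym ; 3F → l≢v ∘ sym })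
                 (trans (set-same o l) (sym (env-at _ _ 1F)))

      -- Among coincidence elements of Z3 two coincide, and each coincidence collapses the tuple.
      dead-u : (∀ o x y z → value o x y z x ≡ g o x x) → (∀ o x y z → value o x y z y ≡ g o x y) →
               (∀ o x y z → value o x y z z ≡ g o x z) → Dead u
      dead-u wx wy wz {X} {Y} r = trans (self X) (trans (value-g X (X p) (X q) (X u) (X v))
        (trans (cong₂ (g X) (≈-at r (u≢p ∘ sym)) (≈-at r v≢u))
        (trans (at-cong _ λ m m∉ → ≈-at r λ e → m∉ 2F (sym e))
        (sym (trans (self Y) (value-g Y (Y p) (Y q) (Y u) (Y v)))))))
        where
        value-g : ∀ o x y z w → value o x y z w ≡ g o x w
        value-g o x y z w with coincidence x y z w
        ... | inj₁ refl = diag o x z w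
        ... | inj₂ (inj₁ refl) = p-value true P o x y w
        ... | inj₂ (inj₂ (inj₁ refl)) = q-value true Q o x y w
        ... | inj₂ (inj₂ (inj₂ (inj₁ refl))) = wx o x y z
        ... | inj₂ (inj₂ (inj₂ (inj₂ (inj₁ refl)))) = wy o x y z
        ... | inj₂ (inj₂ (inj₂ (inj₂ (inj₂ refl)))) = wz o x y z

      wy-of : Indep q v u → ∀ o x y z → value o x y z y ≡ g o x y
      wy-of I o x y z = collapsed (collapses-v≡q I (sym (at-eq 1F 3F refl)))

      wz-of : Indep u v q → ∀ o x y z → value o x y z z ≡ g o x z
      wz-of I o x y z = trans (at-indep 2F 3F 1F (λ ()) (λ ()) I o _ x refl) (diag o x z z)

    -- A second removable variable.

    module Second (V : Indep p q v) where

      p-side′ q-side′ : Bool → Set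
      p-side′ s = if s then Indep p v q else Good p v
      q-side′ s = if s then Good q v else Indep q v p

      p-value′ : ∀ s → p-side′ s → ∀ o x y z → value o x y z x ≡ g o (pick s x y) (pick s x y)
      p-value′ true  I o x y z = trans (at-indep 0F 3F 1F (λ ()) (λ ()) I o _ x refl) (diag o x z x)
      p-value′ false G o x y z = trans (at-good 0F 3F G o _ y refl) (diag o y z y)

      q-value′ : ∀ s → q-side′ s → ∀ o x y z → value o x y z y ≡ g o (pick s x y) (pick s x y)
      q-value′ true  G o x y z = trans (at-good 1F 3F G o _ x refl) (diag o x z x)
      q-value′ false I o x y z = trans (at-indep 1F 3F 0F (λ ()) (λ ()) I o _ y refl) (diag o y z y)

      module _ (bad : ¬ Good p q) where

        -- Both formulas apply where `x u` and `x v` lie in `{x p, x q}`. If they chose different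
        -- entries, `g`, which ignores its second argument by `V`, would ignore its first one as
        -- well.
        consistent : ∀ e e′ {s s′} → (∀ o x y w → value o x y (pick e x y) w ≡ g o (pick s x y) w) →
                     (∀ o x y z → value o x y z (pick e′ x y) ≡ g o (pick s′ x y) (pick s′ x y)) → s ≡ s′
        consistent e e′ {true}  {true}  A B = refl
        consistent e e′ {false} {false} A B = refl
        consistent e e′ {true}  {false} A B = ⊥-elim (bad (good-pq λ o x y w →
          trans (indep-v-elim V o x w _) (trans (sym (A o x y (pick e′ x y)))
            (trans (B o x y _) (indep-v-elim V o y y w)))))
        consistent e e′ {false} {true}  A B = ⊥-elim (bad (good-pq λ o y x w →
          trans (indep-v-elim V o y w _) (trans (sym (A o x y (pick e′ x y)))
            (trans (B o x y _) (indep-v-elim V o x x w)))))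

        -- Three comparisons link all four codes, so `u` and `v` follow the same projection.
        sides-agree : ∀ {s₁ s₂ t₁ t₂} → p-side s₁ → q-side s₂ → p-side′ t₁ → q-side′ t₂ →
                      s₁ ≡ t₁ × s₂ ≡ t₁ × s₁ ≡ t₂
        sides-agree {s₁} {s₂} {t₁} {t₂} P Q P′ Q′ =
          consistent true true (p-value s₁ P) (p-value′ t₁ P′) ,
          consistent false true (q-value s₂ Q) (p-value′ t₁ P′) ,
          consistent true false (p-value s₁ P) (q-value′ t₂ Q′)

        collapses-v≡q′ : Good q v → ∀ {X} → X v ≡ X q → Collapses X
        collapses-v≡q′ Q′ {X} e = collapses X (trans (cong (value X (X p) (X q) (X u)) e)
          (trans (q-value′ true Q′ X (X p) (X q) (X u)) (indep-v-elim V X (X p) (X p) (X v))))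

        dead-u′ : Indep p u q → Good q u → Indep p v q → Good q v → Loses u v →
                  (∀ {t} → Off t → Indep p q t → ∀ {X} → X t ≡ X q → Collapses X) → Dead u
        dead-u′ P Q P′ Q′ uv T = Projection.dead-u P Q (p-value′ true P′)
          (λ o x y z → trans (q-value′ true Q′ o x y z) (indep-v-elim V o x x y)) (wz uv)
          where
          wz : Loses u v → ∀ o x y z → value o x y z z ≡ g o x z
          wz (inj₁ G) o x y z = trans (at-good 2F 3F G o _ x refl)
            (trans (p-value true P o x y x) (indep-v-elim V o x x z))
          wz (inj₂ (l , l≢u , l≢v , I)) o x y z with l ≟ p | l ≟ q
          ... | yes refl | _ = ⊥-elim (bad (good-pq λ o x y w → trans (h o x w) (sym (h o y w))))
            where
            h : ∀ o x w → g o x w ≡ g o w w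
            h o x w = trans (sym (q-value true Q o x w w)) (at-indep 2F 3F 0F (λ ()) (λ ()) I o _ w refl)
          ... | no _ | yes refl = Projection.wz-of P Q I o x y z
          -- By `h` the outside variable `l` is also lost by `p`, `q`, so `T` applies after `l` has
          -- been set to `x q`.
          ... | no l≢p | no l≢q = trans (at-indep-off 2F 3F I _ (set-≈ o) refl)
                  (trans (collapsed (T off (indep-t off h) same)) (sym (h x z (set-≈ o))))
            where
            off : Off l
            off = l≢p , l≢q , l≢u , l≢v
            same : env (set o l y) (x ∷ y ∷ z ∷ z ∷ []) l ≡ env (set o l y) (x ∷ y ∷ z ∷ z ∷ []) q
            same = trans (env-off _ _ λ { 0F → l≢p ∘ sym ; 1F → l≢q ∘ sym ; 2F → l≢u ∘ sym ; 3F → l≢v ∘ sym })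
                     (trans (set-same o l) (sym (env-at _ _ 1F)))
            h : ∀ {o o′} x w → o ≈[ _≡ l ] o′ → g o x w ≡ g o′ x w
            h {o} {o′} x w r = trans (sym (q-value true Q o x w w))
              (trans (at-indep-off 2F 3F I _ r refl) (q-value true Q o′ x w w))

  -- All pairs are good: induction on removable variables.

  module Main (4≤n : 4 ≤ n) (loses : ∀ {i j} → i ≢ j → Loses i j) (alive : ∀ l → ¬ Dead l)
              (indep? : ∀ i j l → Dec (Indep i j l)) where

    removable? : ∀ p q l → Dec (l ≢ p × l ≢ q × Indep p q l)
    removable? p q l = ¬? (l ≟ p) ×-dec ¬? (l ≟ q) ×-dec indep? p q l

    Removable : Fin n → Fin n → Subset n
    Removable p q = select (removable? p q)

    -- Inclusion comes from `Indep-trans`, with `w = q` ruled out by `¬I`. It is strict because `u`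
    -- cannot be removable for a pair that contains it.
    removable-⊂ : ∀ {p q u} → u ≢ p → u ≢ q → Indep p q u → ¬ Indep p u q → Removable p u ⊂ Removable p q
    removable-⊂ {p} {q} {u} u≢p u≢q H ¬I =
      (λ {w} w∈ → let (w≢p , w≢u , J) = select-∈ (removable? p u) w∈ in
        ∈-select (removable? p q) (w≢p , (λ { refl → ¬I J }) , Indep-trans u≢p u≢q w≢u w≢p H J)) ,
      u , ∈-select (removable? p q) (u≢p , u≢q , H) ,
      λ u∈ → proj₁ (proj₂ (select-∈ (removable? p u) u∈)) refl

    module Step {p q u} (p≢q : p ≢ q) (u≢p : u ≢ p) (u≢q : u ≢ q) (H : Indep p q u) (bad : ¬ Good p q)
                (side-p : ∀ {t} → t ≢ p → t ≢ q → Indep p q t → Good p t ⊎ Indep p t q)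
                (side-q : ∀ {t} → t ≢ p → t ≢ q → Indep p q t → Good q t ⊎ Indep q t p) where

      dead-second : ∀ {v} → v ≢ p → v ≢ q → v ≢ u → Indep p q v →
                    Indep p u q → Good q u → Indep p v q → Good q v → ⊥
      dead-second v≢p v≢q v≢u V P Q P′ Q′ =
        alive u (Quad.Second.dead-u′ p≢q u≢p u≢q v≢p v≢q v≢u H V bad P Q P′ Q′ (loses (v≢u ∘ sym))
          λ { (t≢p , t≢q , t≢u , _) T → Quad.Second.collapses-v≡q′ p≢q u≢p u≢q t≢p t≢q t≢u H T bad (good-q t≢p t≢q t≢u T) })
        where
        good-q : ∀ {t} → t ≢ p → t ≢ q → t ≢ u → Indep p q t → Good q t
        good-q t≢p t≢q t≢u T with side-q t≢p t≢q T
        ... | inj₁ G = G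
        -- Here `t` would have code false while `u` has code true.
        ... | inj₂ I with Quad.Second.consistent p≢q u≢p u≢q t≢p t≢q t≢u H T bad true false
                           (Quad.p-value p≢q u≢p u≢q t≢p t≢q t≢u H true P)
                           (Quad.Second.q-value′ p≢q u≢p u≢q t≢p t≢q t≢u H T false I)
        ... | ()

      -- For every outside `v` the minors of `u`, `v` and of `q`, `v` lose `q` and `u` respectively.
      -- Hence each coincidence among the four entries gives `g` at `x p`, and `u` is inessential.
      dead-only : ∀ {v} → v ≢ p → v ≢ q → v ≢ u → (∀ {t} → t ≢ p → t ≢ q → t ≢ u → ¬ Indep p q t) →
                  Indep p u q → Good q u → ⊥
      dead-only {v} v≢p v≢q v≢u none P Q = alive u (Pr.dead-u
          (Pr.v≡p-value (uvq v≢p v≢q v≢u) (qvu v≢p v≢q v≢u) (loses (v≢p ∘ sym))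
            λ { (t≢p , t≢q , t≢u , _) → Quad.Projection.collapses-v≡q p≢q u≢p u≢q t≢p t≢q t≢u H P Q (qvu t≢p t≢q t≢u) })
          (Pr.wy-of (qvu v≢p v≢q v≢u)) (Pr.wz-of (uvq v≢p v≢q v≢u)))
        where
        module Pr = Quad.Projection p≢q u≢p u≢q v≢p v≢q v≢u H P Q
        none-off : ∀ {v t} → t ≢ p × t ≢ q × t ≢ u × t ≢ v → ¬ Indep p q t
        none-off (a , b , c , _) = none a b c
        module Ct {v} (v≢p : v ≢ p) (v≢q : v ≢ q) (v≢u : v ≢ u) =
          Quad.Contradictions p≢q u≢p u≢q v≢p v≢q v≢u H bad none-off (none v≢p v≢q v≢u)
        uvq : ∀ {v} → v ≢ p → v ≢ q → v ≢ u → Indep u v q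
        uvq v≢p v≢q v≢u = Ct.uv-loses-q v≢p v≢q v≢u P Q (loses (v≢u ∘ sym))
        qvu : ∀ {v} → v ≢ p → v ≢ q → v ≢ u → Indep q v u
        qvu v≢p v≢q v≢u = Ct.qv-loses-u v≢p v≢q v≢u P Q (loses (v≢q ∘ sym))

      not-mixed : ∀ {v} → v ≢ p → v ≢ q → v ≢ u → (∀ {t} → t ≢ p → t ≢ q → t ≢ u → ¬ Indep p q t) →
                  (Good p u × Good q u) ⊎ (Indep p u q × Indep q u p) → ⊥
      not-mixed v≢p v≢q v≢u none s = [ (λ { (P , Q) → go true (Qd.p-value false P) (Qd.q-value true Q) })
                                     , (λ { (P , Q) → go false (Qd.q-value false Q) (Qd.p-value true P) }) ]′ s
        where
        module Qd = Quad p≢q u≢p u≢q v≢p v≢q v≢u H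
        go = λ e A B → Qd.Contradictions.not-mixed bad (λ (a , b , c , _) → none a b c) (none v≢p v≢q v≢u) e A B
               (loses (v≢p ∘ sym))

    good : ∀ {p q} → Acc _⊂_ (Removable p q) → p ≢ q → Good p q
    good {p} {q} (acc rs) p≢q with loses p≢q
    ... | inj₁ G = G
    ... | inj₂ (u , u≢p , u≢q , H) = λ ex ey r →
            -- Goodness consists of equalities in `Z3`, which are decidable, so it may be proved by
            -- contradiction.
            decidable-stable (_ ≟ _) λ Fx≢Fy → absurd λ G → Fx≢Fy (G ex ey r)
      where
      side-p : ∀ {t} → t ≢ p → t ≢ q → Indep p q t → Good p t ⊎ Indep p t q
      side-p {t} t≢p t≢q T with indep? p t q
      ... | yes I = inj₂ I
      -- If `q` is not lost, the pair `p`, `t` has strictly fewer removable variables and the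
      -- induction hypothesis applies.
      ... | no ¬I = inj₁ (good (rs (removable-⊂ t≢p t≢q T ¬I)) (t≢p ∘ sym))
      side-q : ∀ {t} → t ≢ p → t ≢ q → Indep p q t → Good q t ⊎ Indep q t p
      side-q {t} t≢p t≢q T with indep? q t p
      ... | yes I = inj₂ I
      ... | no ¬I = inj₁ (good (rs (⊂-swap (removable-⊂ t≢q t≢p (Indep-sym T) ¬I))) (t≢q ∘ sym))
        where
        ⊂-swap : ∀ {S} → S ⊂ Removable q p → S ⊂ Removable p q
        ⊂-swap (S⊆ , w , w∈ , w∉) = swap ∘ S⊆ , w , swap w∈ , w∉
          where
          swap : ∀ {w} → w ∈ Removable q p → w ∈ Removable p q
          swap w∈ = let (a , b , I) = select-∈ (removable? q p) w∈ in ∈-select (removable? p q) (b , a , Indep-sym I)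
      absurd : ¬ ¬ Good p q
      absurd bad with any? (λ v → ¬? (v ≟ p) ×-dec ¬? (v ≟ q) ×-dec ¬? (v ≟ u) ×-dec indep? p q v)
      ... | no none = only (side-p u≢p u≢q H) (side-q u≢p u≢q H)
        where
        module St = Step p≢q u≢p u≢q H bad side-p side-q
        -- Exchanging `p` and `q` covers the projection onto `x q`.
        module St′ = Step (p≢q ∘ sym) u≢q u≢p (Indep-sym H) (bad ∘ Good-sym)
                       (λ a b → side-q b a ∘ Indep-sym) (λ a b → side-p b a ∘ Indep-sym)
        none′ : ∀ {t} → t ≢ p → t ≢ q → t ≢ u → ¬ Indep p q t
        none′ a b c I = none (_ , a , b , c , I)
        only : Good p u ⊎ Indep p u q → Good q u ⊎ Indep q u p → ⊥
        only P Q with fresh 4≤n p q u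
        only (inj₁ P) (inj₁ Q) | v , v≢p , v≢q , v≢u = St.not-mixed v≢p v≢q v≢u none′ (inj₁ (P , Q))
        only (inj₂ P) (inj₂ Q) | v , v≢p , v≢q , v≢u = St.not-mixed v≢p v≢q v≢u none′ (inj₂ (P , Q))
        only (inj₂ P) (inj₁ Q) | v , v≢p , v≢q , v≢u = St.dead-only v≢p v≢q v≢u none′ P Q
        only (inj₁ P) (inj₂ Q) | v , v≢p , v≢q , v≢u =
          St′.dead-only v≢q v≢p v≢u (λ a b c I → none′ b a c (Indep-sym I)) Q P
      ... | yes (v , v≢p , v≢q , v≢u , V) = second (code (side-p u≢p u≢q H)) (code′ (side-q u≢p u≢q H))
                                                   (code (side-p v≢p v≢q V)) (code′ (side-q v≢p v≢q V))
        where
        module St = Step p≢q u≢p u≢q H bad side-p side-q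
        module St′ = Step (p≢q ∘ sym) u≢q u≢p (Indep-sym H) (bad ∘ Good-sym)
                       (λ a b → side-q b a ∘ Indep-sym) (λ a b → side-p b a ∘ Indep-sym)
        module Se = Quad.Second p≢q u≢p u≢q v≢p v≢q v≢u H V
        code : ∀ {A B : Set} → A ⊎ B → ∃ λ s → if s then B else A
        code = [ (λ a → false , a) , (λ b → true , b) ]′
        code′ : ∀ {A B : Set} → A ⊎ B → ∃ λ s → if s then A else B
        code′ = [ (λ a → true , a) , (λ b → false , b) ]′
        second : (∃ λ s → if s then Indep p u q else Good p u) → (∃ λ s → if s then Good q u else Indep q u p) →
                 (∃ λ s → if s then Indep p v q else Good p v) → (∃ λ s → if s then Good q v else Indep q v p) → ⊥
        second (s₁ , P) (s₂ , Q) (t₁ , P′) (t₂ , Q′)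
          with Se.sides-agree bad {s₁} {s₂} {t₁} {t₂} P Q P′ Q′
        second (true , P) (_ , Q) (_ , P′) (_ , Q′) | refl , refl , refl =
          St.dead-second v≢p v≢q v≢u V P Q P′ Q′
        second (false , P) (_ , Q) (_ , P′) (_ , Q′) | refl , refl , refl =
          St′.dead-second v≢q v≢p v≢u (Indep-sym V) Q P Q′ P′

    all-good : ∀ {p q} → p ≢ q → Good p q
    all-good = good (⊂-wellFounded _)

-- The Boolean group of subsets and its linear maps.

⊕-comm : ∀ S T → S ⊕ T ≡ T ⊕ S
⊕-comm = zipWith-comm xor-comm

⊕-assoc : ∀ S T U → (S ⊕ T) ⊕ U ≡ S ⊕ (T ⊕ U)
⊕-assoc = zipWith-assoc xor-assoc

⊕-identityˡ : ∀ S → ∅ ⊕ S ≡ S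
⊕-identityˡ = zipWith-identityˡ xor-identityˡ

⊕-identityʳ : ∀ S → S ⊕ ∅ ≡ S
⊕-identityʳ = zipWith-identityʳ xor-identityʳ

⊕-self : ∀ S → S ⊕ S ≡ ∅
⊕-self (a ∷ b ∷ c ∷ []) rewrite xor-same a | xor-same b | xor-same c = refl

⊕-medial : ∀ S T U V → (S ⊕ T) ⊕ (U ⊕ V) ≡ (S ⊕ U) ⊕ (T ⊕ V)
⊕-medial S T U V = begin
  (S ⊕ T) ⊕ (U ⊕ V)  ≡⟨ ⊕-assoc S T (U ⊕ V) ⟩
  S ⊕ (T ⊕ (U ⊕ V))  ≡⟨ cong (S ⊕_) (sym (⊕-assoc T U V)) ⟩
  S ⊕ ((T ⊕ U) ⊕ V)  ≡⟨ cong (λ X → S ⊕ (X ⊕ V)) (⊕-comm T U) ⟩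
  S ⊕ ((U ⊕ T) ⊕ V)  ≡⟨ cong (S ⊕_) (⊕-assoc U T V) ⟩
  S ⊕ (U ⊕ (T ⊕ V))  ≡⟨ sym (⊕-assoc S U (T ⊕ V)) ⟩
  (S ⊕ U) ⊕ (T ⊕ V)  ∎
  where open ≡-Reasoning

infixr 7 _·_
_·_ : Bool → Subset 3 → Subset 3
b · S = if b then S else ∅

·-xor : ∀ a b S → (a xor b) · S ≡ a · S ⊕ b · S
·-xor true true S = sym (⊕-self S)
·-xor true false S = sym (⊕-identityʳ S)
·-xor false b S = sym (⊕-identityˡ (b · S))

-- The group endomorphism of the power set whose values on singletons are given by `g`.
linear : (Z3 → Subset 3) → Subset 3 → Subset 3
linear g (a ∷ b ∷ c ∷ []) = a · g 0F ⊕ (b · g 1F ⊕ c · g 2F)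

linear-⊕ : ∀ g S T → linear g (S ⊕ T) ≡ linear g S ⊕ linear g T
linear-⊕ g (a ∷ b ∷ c ∷ []) (a′ ∷ b′ ∷ c′ ∷ [])
  rewrite ·-xor a a′ (g 0F) | ·-xor b b′ (g 1F) | ·-xor c c′ (g 2F)
        | ⊕-medial (b · g 1F) (b′ · g 1F) (c · g 2F) (c′ · g 2F) =
  ⊕-medial (a · g 0F) (a′ · g 0F) _ _

linear-single : ∀ g x → linear g ⁅ x ⁆ ≡ g x
linear-single g 0F = ⊕-identityʳ (g 0F)
linear-single g 1F = trans (⊕-identityˡ _) (⊕-identityʳ _)
linear-single g 2F = trans (⊕-identityˡ _) (⊕-identityˡ _)

-- Equal singletons cancel in pairs, which leaves the values that occur an odd number of times.
odd-set : ∀ {n} → Tuple n → Subset 3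
odd-set = ⊕-single ⁅_⁆

single-linear : ∀ {n} g (xs : Tuple n) → ⊕-single g xs ≡ linear g (odd-set xs)
single-linear g [] = refl
single-linear g (x ∷ xs) = begin
  g x ⊕ ⊕-single g xs                     ≡⟨ cong₂ _⊕_ (sym (linear-single g x)) (single-linear g xs) ⟩
  linear g ⁅ x ⁆ ⊕ linear g (odd-set xs)  ≡⟨ sym (linear-⊕ g ⁅ x ⁆ (odd-set xs)) ⟩
  linear g (odd-set (x ∷ xs))             ∎
  where open ≡-Reasoning

-- The four formulas as functions of the odd set.

parity : Subset 3 → Bool
parity (a ∷ b ∷ c ∷ []) = a xor (b xor c)

-- Sets of equal parity are separated by key: a singleton or a pair is recovered from its sum.
key : Subset 3 → Maybe Z3
key (false ∷ false ∷ false ∷ []) = nothing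
key (true  ∷ true  ∷ true  ∷ []) = nothing
key (true  ∷ false ∷ false ∷ []) = just 0F
key (false ∷ true  ∷ false ∷ []) = just 1F
key (false ∷ false ∷ true  ∷ []) = just 2F
key (false ∷ true  ∷ true  ∷ []) = just 0F
key (true  ∷ true  ∷ false ∷ []) = just 1F
key (true  ∷ false ∷ true  ∷ []) = just 2F

-- The common closed form of all four formulas. The key `nothing`, shared by the empty and the full
-- set, receives `d`.
val : Z3 → Z3 → Z3 → Z3 → Maybe Z3 → Z3
val a b c d = maybe (λ s → poly a b c s +₃ d) d

all-Bool? : {P : Bool → Set} → (∀ b → Dec (P b)) → Dec (∀ b → P b)
all-Bool? {P} P? = map′ (λ (p , q) → to p q) (λ h → h true , h false) (P? true ×-dec P? false)
  where
  to : P true → P false → ∀ b → P b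
  to p q true = p
  to p q false = q

all-Subset? : {P : Subset 3 → Set} → (∀ S → Dec (P S)) → Dec (∀ S → P S)
all-Subset? P? = map′ (λ { h (a ∷ b ∷ c ∷ []) → h a b c }) (λ h a b c → h (a ∷ b ∷ c ∷ []))
  (all-Bool? λ a → all-Bool? λ b → all-Bool? λ c → P? (a ∷ b ∷ c ∷ []))

infix 4 _≟ˢ_
_≟ˢ_ : (S T : Subset 3) → Dec (S ≡ T)
_≟ˢ_ = ≡-dec Bool._≟_

-- Residues in a finite type allow identities over all residues to be checked exhaustively.
mod4 : ℕ → Fin 4
mod4 0 = 0F
mod4 1 = 1F
mod4 2 = 2F
mod4 3 = 3F
mod4 (suc (suc (suc (suc n)))) = mod4 n

next : Fin 4 → Fin 4
next 0F = 1F
next 1F = 2F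
next 2F = 3F
next 3F = 0F

mod4-suc : ∀ n → mod4 (suc n) ≡ next (mod4 n)
mod4-suc 0 = refl
mod4-suc 1 = refl
mod4-suc 2 = refl
mod4-suc 3 = refl
mod4-suc (suc (suc (suc (suc n)))) = mod4-suc n

toℕ-mod4 : ∀ n → toℕ (mod4 n) ≡ n % 4
toℕ-mod4 0 = refl
toℕ-mod4 1 = refl
toℕ-mod4 2 = refl
toℕ-mod4 3 = refl
toℕ-mod4 (suc (suc (suc (suc n)))) = toℕ-mod4 n

odd : Fin 4 → Bool
odd 0F = false
odd 1F = true
odd 2F = false
odd 3F = true

odd-next : ∀ r → odd (next r) ≡ not (odd r)
odd-next 0F = refl
odd-next 1F = refl
odd-next 2F = refl
odd-next 3F = refl

parity-insert : ∀ x S → parity (⁅ x ⁆ ⊕ S) ≡ not (parity S)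
parity-insert = toWitness {a? = all? λ x → all-Subset? λ S → parity (⁅ x ⁆ ⊕ S) Bool.≟ not (parity S)} _

parity-odd-set : ∀ {n} (xs : Tuple n) → parity (odd-set xs) ≡ odd (mod4 n)
parity-odd-set [] = refl
parity-odd-set {suc n} (x ∷ xs) = begin
  parity (⁅ x ⁆ ⊕ odd-set xs)  ≡⟨ parity-insert x (odd-set xs) ⟩
  not (parity (odd-set xs))    ≡⟨ cong not (parity-odd-set xs) ⟩
  not (odd (mod4 n))           ≡⟨ sym (odd-next (mod4 n)) ⟩
  odd (next (mod4 n))          ≡⟨ cong odd (sym (mod4-suc n)) ⟩
  odd (mod4 (suc n))           ∎
  where open ≡-Reasoning

key-injective : ∀ S T → parity S ≡ parity T → key S ≡ key T → S ≡ T
key-injective = toWitness {a? = all-Subset? λ S → all-Subset? λ T →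
  (parity S Bool.≟ parity T) →-dec ((key S ≟ᵏ key T) →-dec (S ≟ˢ T))} _
  where
  open import Data.Maybe.Properties using () renaming (≡-dec to Maybe-≡-dec)
  _≟ᵏ_ = Maybe-≡-dec (_≟_ {3})

module _ (a b c d : Z3) where

  -- The number of pairs of equal entries has the parity of r(r-1)/2 minus the number of pairs in S.
  pairs-value : Fin 4 → Subset 3 → Subset 3
  pairs-value r S@(x ∷ y ∷ z ∷ []) =
    (two-or-three r xor ((x ∧ y) xor ((x ∧ z) xor (y ∧ z)))) · ⁅ d ⁆ ⊕
    ((x ∧ y) · pairTerm a b c d 0F 1F ⊕ ((x ∧ z) · pairTerm a b c d 0F 2F ⊕ (y ∧ z) · pairTerm a b c d 1F 2F))
    where
    two-or-three : Fin 4 → Bool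
    two-or-three 0F = false
    two-or-three 1F = false
    two-or-three 2F = true
    two-or-three 3F = true

  rhs : ∀ {n} → Fin 4 → Tuple n → Subset 3
  rhs 0F x = ⊕-pairs (pairTerm a b c d) x ⊕ ⁅ d ⁆
  rhs 1F x = ⊕-pairs (pairTerm a b c d) x ⊕ ⊕-single (singleTerm a b c d) x
  rhs 2F x = ⊕-pairs (pairTerm a b c d) x
  rhs 3F x = ⊕-pairs (pairTerm a b c d) x ⊕ ⊕-single (singleTerm a b c d) x ⊕ ⁅ d ⁆

  completion : Fin 4 → Subset 3 → Subset 3
  completion 0F S = pairs-value 0F S ⊕ ⁅ d ⁆
  completion 1F S = pairs-value 1F S ⊕ linear (singleTerm a b c d) S
  completion 2F S = pairs-value 2F S
  completion 3F S = pairs-value 3F S ⊕ linear (singleTerm a b c d) S ⊕ ⁅ d ⁆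

-- Prepending `x` pairs it with every other entry, which adds the linear extension of its pair terms
-- at `S`. The parity condition ties `S` to the length residue `r`; the finitely many cases are
-- evaluated.
step-holds : ∀ a b c d r x S → parity S ≡ odd r →
  linear (pairTerm a b c d x) S ⊕ pairs-value a b c d r S ≡ pairs-value a b c d (next r) (⁅ x ⁆ ⊕ S)
step-holds = toWitness {a? = all? λ a → all? λ b → all? λ c → all? λ d → all? λ r → all? λ x → all-Subset? λ S →
  (parity S Bool.≟ odd r) →-dec (linear (pairTerm a b c d x) S ⊕ pairs-value a b c d r S ≟ˢ pairs-value a b c d (next r) (⁅ x ⁆ ⊕ S))} _

-- The extra summands vary with the residue so that every case ends in the same singleton, in which
-- `r` no longer occurs.
completion-holds : ∀ a b c d r S → parity S ≡ odd r → completion a b c d r S ≡ ⁅ val a b c d (key S) ⁆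
completion-holds = toWitness {a? = all? λ a → all? λ b → all? λ c → all? λ d → all? λ r → all-Subset? λ S →
  (parity S Bool.≟ odd r) →-dec (completion a b c d r S ≟ˢ ⁅ val a b c d (key S) ⁆)} _

pairs-odd-set : ∀ {n} a b c d (x : Tuple n) →
                ⊕-pairs (pairTerm a b c d) x ≡ pairs-value a b c d (mod4 n) (odd-set x)
pairs-odd-set a b c d [] = refl
pairs-odd-set {suc n} a b c d (x ∷ xs) = begin
  ⊕-single (pairTerm a b c d x) xs ⊕ ⊕-pairs (pairTerm a b c d) xs
    ≡⟨ cong₂ _⊕_ (single-linear _ xs) (pairs-odd-set a b c d xs) ⟩
  linear (pairTerm a b c d x) (odd-set xs) ⊕ pairs-value a b c d (mod4 n) (odd-set xs)
    ≡⟨ step-holds a b c d (mod4 n) x (odd-set xs) (parity-odd-set xs) ⟩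
  pairs-value a b c d (next (mod4 n)) (odd-set (x ∷ xs))
    ≡⟨ cong (λ r → pairs-value a b c d r (odd-set (x ∷ xs))) (sym (mod4-suc n)) ⟩
  pairs-value a b c d (mod4 (suc n)) (odd-set (x ∷ xs)) ∎
  where open ≡-Reasoning

rhs-val : ∀ {n} a b c d (x : Tuple n) → rhs a b c d (mod4 n) x ≡ ⁅ val a b c d (key (odd-set x)) ⁆
rhs-val {n} a b c d x = trans (go (mod4 n) refl)
    (completion-holds a b c d (mod4 n) (odd-set x) (parity-odd-set x))
  where
  pairs : ∀ {r} → mod4 n ≡ r → ⊕-pairs (pairTerm a b c d) x ≡ pairs-value a b c d r (odd-set x)
  pairs refl = pairs-odd-set a b c d x
  go : ∀ r → mod4 n ≡ r → rhs a b c d r x ≡ completion a b c d r (odd-set x)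
  go 0F e = cong (_⊕ _) (pairs e)
  go 1F e = cong₂ _⊕_ (pairs e) (single-linear _ x)
  go 2F e = pairs e
  go 3F e = cong (_⊕ _) (cong₂ _⊕_ (pairs e) (single-linear _ x))

DependsOnKey : ∀ n → (Tuple n → Z3) → Z3 → Z3 → Z3 → Z3 → Set
DependsOnKey n f a b c d = ∀ x → f x ≡ val a b c d (key (odd-set x))

module _ {n} {f : Tuple n → Z3} {a b c d : Z3} where

  form⇒val : HasForm n f a b c d → DependsOnKey n f a b c d
  form⇒val h x = x∈⁅y⁆⇒x≡y _ (subst (f x ∈_) (trans (go (mod4 n) (toℕ-mod4 n)) (rhs-val a b c d x)) (x∈⁅x⁆ (f x)))
    where
    go : ∀ r → toℕ r ≡ n % 4 → ⁅ f x ⁆ ≡ rhs a b c d r x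
    go 0F e = proj₁ (h x) (sym e)
    go 1F e = proj₁ (proj₂ (h x)) (sym e)
    go 2F e = proj₁ (proj₂ (proj₂ (h x))) (sym e)
    go 3F e = proj₂ (proj₂ (proj₂ (h x))) (sym e)

  val⇒form : DependsOnKey n f a b c d → HasForm n f a b c d
  val⇒form h x = go 0F , go 1F , go 2F , go 3F
    where
    go : ∀ r → n % 4 ≡ toℕ r → ⁅ f x ⁆ ≡ rhs a b c d r x
    go r e = trans (cong ⁅_⁆ (h x)) (trans (sym (rhs-val a b c d x))
      (cong (λ r → rhs a b c d r x) (toℕ-injective (trans (toℕ-mod4 n) e))))

-- Realizing all keys and interpolating functions of the key.

Realized : ℕ → Subset 3 → Set
Realized n S = ∃ λ (x : Tuple n) → odd-set x ≡ S

realized-+2 : ∀ {n S} → Realized n S → Realized (suc (suc n)) S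
realized-+2 {S = S} (x , refl) = 0F ∷ 0F ∷ x , trans (sym (⊕-assoc ⁅ 0F ⁆ ⁅ 0F ⁆ S)) (⊕-identityˡ S)

key-realized : ∀ n k → ∃ λ (x : Tuple (suc (suc n))) → key (odd-set x) ≡ k
key-realized 0 nothing = 0F ∷ 0F ∷ [] , refl
key-realized 0 (just 0F) = 1F ∷ 2F ∷ [] , refl
key-realized 0 (just 1F) = 0F ∷ 1F ∷ [] , refl
key-realized 0 (just 2F) = 0F ∷ 2F ∷ [] , refl
key-realized 1 nothing = 0F ∷ 1F ∷ 2F ∷ [] , refl
key-realized 1 (just 0F) = 0F ∷ 0F ∷ 0F ∷ [] , refl
key-realized 1 (just 1F) = 0F ∷ 0F ∷ 1F ∷ [] , refl
key-realized 1 (just 2F) = 0F ∷ 0F ∷ 2F ∷ [] , refl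
key-realized (suc (suc n)) k with key-realized n k
... | x , e with realized-+2 (x , refl)
...   | y , e′ = y , trans (cong key e′) e

-- Lagrange interpolation at 0, 1 and 2 over Z3.
lagrange : Z3 → Z3 → Z3 → Z3 × Z3 × Z3
lagrange u v w = v +₃ v -₃ w -₃ u , w -₃ v , u

lagrange-poly : ∀ a b c → lagrange (poly a b c 0F) (poly a b c 1F) (poly a b c 2F) ≡ (a , b , c)
lagrange-poly = toWitness {a? = all? λ a → all? λ b → all? λ c →
  ×-≡-dec _≟_ (×-≡-dec _≟_ _≟_) (lagrange (poly a b c 0F) (poly a b c 1F) (poly a b c 2F)) (a , b , c)} _

poly-lagrange : ∀ u v w → let (a , b , c) = lagrange u v w in
                poly a b c 0F ≡ u × poly a b c 1F ≡ v × poly a b c 2F ≡ w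
poly-lagrange = toWitness {a? = all? λ u → all? λ v → all? λ w → let (a , b , c) = lagrange u v w in
  (poly a b c 0F ≟ u) ×-dec ((poly a b c 1F ≟ v) ×-dec (poly a b c 2F ≟ w))} _

+₃-cancel : ∀ x d → x +₃ d -₃ d ≡ x
+₃-cancel = toWitness {a? = all? λ x → all? λ d → x +₃ d -₃ d ≟ x} _

-₃-cancel : ∀ x d → x -₃ d +₃ d ≡ x
-₃-cancel = toWitness {a? = all? λ x → all? λ d → x -₃ d +₃ d ≟ x} _

lagrange-cong : ∀ {u u′ v v′ w w′} → u ≡ u′ → v ≡ v′ → w ≡ w′ → lagrange u v w ≡ lagrange u′ v′ w′
lagrange-cong refl refl refl = refl

shift : (Maybe Z3 → Z3) → Z3 → Z3
shift h s = h (just s) -₃ h nothing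

coefficients : (Maybe Z3 → Z3) → Z3 × Z3 × Z3
coefficients h = lagrange (shift h 0F) (shift h 1F) (shift h 2F)

coefficients-cong : ∀ {h h′ : Maybe Z3 → Z3} → (∀ k → h k ≡ h′ k) → coefficients h ≡ coefficients h′
coefficients-cong e = lagrange-cong (go 0F) (go 1F) (go 2F)
  where
  go = λ s → cong₂ _-₃_ (e (just s)) (e nothing)

coefficients-val : ∀ a b c d → coefficients (val a b c d) ≡ (a , b , c)
coefficients-val a b c d = trans (lagrange-cong (go 0F) (go 1F) (go 2F)) (lagrange-poly a b c)
  where
  go = λ s → +₃-cancel (poly a b c s) d

-- The value at `nothing` is `d`; the differences from it are the values of the polynomial at 0, 1
-- and 2, which determine its coefficients.
val-injective : ∀ a b c d a′ b′ c′ d′ → (∀ k → val a b c d k ≡ val a′ b′ c′ d′ k) →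
                a ≡ a′ × b ≡ b′ × c ≡ c′ × d ≡ d′
val-injective a b c d a′ b′ c′ d′ h = cong proj₁ e , cong (proj₁ ∘ proj₂) e , cong (proj₂ ∘ proj₂) e , h nothing
  where
  e : (a , b , c) ≡ (a′ , b′ , c′)
  e = trans (sym (coefficients-val a b c d)) (trans (coefficients-cong h) (coefficients-val a′ b′ c′ d′))

interpolate : ∀ (h : Maybe Z3 → Z3) → let (a , b , c) = coefficients h in ∀ k → val a b c (h nothing) k ≡ h k
interpolate h nothing = refl
interpolate h (just s) = trans (cong (_+₃ h nothing) (fits s)) (-₃-cancel (h (just s)) (h nothing))
  where
  P = poly-lagrange (shift h 0F) (shift h 1F) (shift h 2F)
  fits : ∀ s → let (a , b , c) = coefficients h in poly a b c s ≡ shift h s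
  fits 0F = proj₁ P
  fits 1F = proj₁ (proj₂ P)
  fits 2F = proj₂ (proj₂ P)

-- Normal forms of tuples under swaps and replacement of equal pairs.

data _∼_ : ∀ {n} → Tuple n → Tuple n → Set where
  done  : ∀ {n} {x : Tuple n} → x ∼ x
  _then_ : ∀ {n} {x y z : Tuple n} → x ∼ y → y ∼ z → x ∼ z
  swap  : ∀ {n a b} {x : Tuple n} → (a ∷ b ∷ x) ∼ (b ∷ a ∷ x)
  twin  : ∀ {n a b} {x : Tuple n} → (a ∷ a ∷ x) ∼ (b ∷ b ∷ x)
  keep  : ∀ {n a} {x y : Tuple n} → x ∼ y → (a ∷ x) ∼ (a ∷ y)

infixr 5 _then_
infix 4 _∼_

data Zeros : ∀ {n} → Tuple n → Set where
  []   : Zeros []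
  0∷0∷_ : ∀ {n} {x : Tuple n} → Zeros x → Zeros (0F ∷ 0F ∷ x)

Zeros-unique : ∀ {n} {x y : Tuple n} → Zeros x → Zeros y → x ≡ y
Zeros-unique [] [] = refl
Zeros-unique (0∷0∷ z) (0∷0∷ z′) = cong (λ x → 0F ∷ 0F ∷ x) (Zeros-unique z z′)

-- The elements of the set in increasing order, followed by an even number of zeros. The set and the
-- length thus determine the tuple.
data Canonical : ∀ {n} → Subset 3 → Tuple n → Set where
  c∅  : ∀ {n} {x : Tuple n} → Zeros x → Canonical (false ∷ false ∷ false ∷ []) x
  c0  : ∀ {n} {x : Tuple n} → Zeros x → Canonical (true  ∷ false ∷ false ∷ []) (0F ∷ x)
  c1  : ∀ {n} {x : Tuple n} → Zeros x → Canonical (false ∷ true  ∷ false ∷ []) (1F ∷ x)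
  c2  : ∀ {n} {x : Tuple n} → Zeros x → Canonical (false ∷ false ∷ true  ∷ []) (2F ∷ x)
  c01 : ∀ {n} {x : Tuple n} → Zeros x → Canonical (true  ∷ true  ∷ false ∷ []) (0F ∷ 1F ∷ x)
  c02 : ∀ {n} {x : Tuple n} → Zeros x → Canonical (true  ∷ false ∷ true  ∷ []) (0F ∷ 2F ∷ x)
  c12 : ∀ {n} {x : Tuple n} → Zeros x → Canonical (false ∷ true  ∷ true  ∷ []) (1F ∷ 2F ∷ x)
  c012 : ∀ {n} {x : Tuple n} → Zeros x → Canonical (true ∷ true ∷ true ∷ []) (0F ∷ 1F ∷ 2F ∷ x)

Canonical-unique : ∀ {n S} {x y : Tuple n} → Canonical S x → Canonical S y → x ≡ y
Canonical-unique (c∅ z) (c∅ z′) = Zeros-unique z z′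
Canonical-unique (c0 z) (c0 z′) = cong (0F ∷_) (Zeros-unique z z′)
Canonical-unique (c1 z) (c1 z′) = cong (1F ∷_) (Zeros-unique z z′)
Canonical-unique (c2 z) (c2 z′) = cong (2F ∷_) (Zeros-unique z z′)
Canonical-unique (c01 z) (c01 z′) = cong (λ x → 0F ∷ 1F ∷ x) (Zeros-unique z z′)
Canonical-unique (c02 z) (c02 z′) = cong (λ x → 0F ∷ 2F ∷ x) (Zeros-unique z z′)
Canonical-unique (c12 z) (c12 z′) = cong (λ x → 1F ∷ 2F ∷ x) (Zeros-unique z z′)
Canonical-unique (c012 z) (c012 z′) = cong (λ x → 0F ∷ 1F ∷ 2F ∷ x) (Zeros-unique z z′)

sink : ∀ {n a b} {x : Tuple n} → (a ∷ a ∷ b ∷ x) ∼ (b ∷ 0F ∷ 0F ∷ x)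
sink = twin then keep swap then swap

-- A new value is either sorted into the set by swaps or meets its copy; in the latter case the pair
-- becomes two zeros and joins the padding.
insert : ∀ {n S} {x : Tuple n} a → Canonical S x → ∃ λ y → Canonical (⁅ a ⁆ ⊕ S) y × (a ∷ x) ∼ y
insert 0F (c∅ z) = _ , c0 z , done
insert 1F (c∅ z) = _ , c1 z , done
insert 2F (c∅ z) = _ , c2 z , done
insert 0F (c0 z) = _ , c∅ (0∷0∷ z) , done
insert 1F (c0 z) = _ , c01 z , swap
insert 2F (c0 z) = _ , c02 z , swap
insert 0F (c1 z) = _ , c01 z , done
insert 1F (c1 z) = _ , c∅ (0∷0∷ z) , twin
insert 2F (c1 z) = _ , c12 z , swap
insert 0F (c2 z) = _ , c02 z , done
insert 1F (c2 z) = _ , c12 z , done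
insert 2F (c2 z) = _ , c∅ (0∷0∷ z) , twin
insert 0F (c01 z) = _ , c1 (0∷0∷ z) , sink
insert 1F (c01 z) = _ , c0 (0∷0∷ z) , swap then keep twin
insert 2F (c01 z) = _ , c012 z , swap then keep swap
insert 0F (c02 z) = _ , c2 (0∷0∷ z) , sink
insert 1F (c02 z) = _ , c012 z , swap
insert 2F (c02 z) = _ , c0 (0∷0∷ z) , swap then keep twin
insert 0F (c12 z) = _ , c012 z , done
insert 1F (c12 z) = _ , c2 (0∷0∷ z) , sink
insert 2F (c12 z) = _ , c1 (0∷0∷ z) , swap then keep twin
insert 0F (c012 z) = _ , c12 (0∷0∷ z) , sink then keep sink
insert 1F (c012 z) = _ , c02 (0∷0∷ z) , swap then keep sink
insert 2F (c012 z) = _ , c01 (0∷0∷ z) , swap then keep (swap then keep twin)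

canonical : ∀ {n} (x : Tuple n) → ∃ λ y → Canonical (odd-set x) y × x ∼ y
canonical [] = [] , c∅ [] , done
canonical (a ∷ x) =
  let (y , C , r) = canonical x
      (z , C′ , r′) = insert a C
  in z , C′ , keep r then r′

-- The generators `swap` and `twin` at arbitrary positions. This makes the relation closed under
-- prepending an entry and matches what good pairs provide.
Move : ∀ {n} → Tuple n → Tuple n → Set
Move x y = ∃ λ i → ∃ λ j → i ≢ j × (∀ m → (m ≡ i ⊎ m ≡ j) ⊎ lookup x m ≡ lookup y m) ×
  (lookup x i ≡ lookup y j × lookup x j ≡ lookup y i ⊎ lookup x i ≡ lookup x j × lookup y i ≡ lookup y j)

Move-∷ : ∀ {n} {x y : Tuple n} a → Move x y → Move (a ∷ x) (a ∷ y)
Move-∷ a (i , j , i≢j , off , on) = suc i , suc j , i≢j ∘ suc-injective , off′ , on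
  where
  off′ : ∀ m → (m ≡ suc i ⊎ m ≡ suc j) ⊎ _
  off′ zero = inj₂ refl
  off′ (suc m) with off m
  ... | inj₁ (inj₁ refl) = inj₁ (inj₁ refl)
  ... | inj₁ (inj₂ refl) = inj₁ (inj₂ refl)
  ... | inj₂ e = inj₂ e

head-Move : ∀ {n a b a′ b′} {x : Tuple n} → (a ≡ b′ × b ≡ a′ ⊎ a ≡ b × a′ ≡ b′) → Move (a ∷ b ∷ x) (a′ ∷ b′ ∷ x)
head-Move h = 0F , 1F , (λ ()) , (λ { 0F → inj₁ (inj₁ refl) ; 1F → inj₁ (inj₂ refl) ; (suc (suc m)) → inj₂ refl }) , h

∼-invariant : ∀ {n} {x y : Tuple n} → x ∼ y → (f : Tuple n → Z3) → (∀ {x y} → Move x y → f x ≡ f y) → f x ≡ f y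
∼-invariant done f R = refl
∼-invariant (r then s) f R = trans (∼-invariant r f R) (∼-invariant s f R)
∼-invariant swap f R = R (head-Move (inj₁ (refl , refl)))
∼-invariant twin f R = R (head-Move (inj₂ (refl , refl)))
∼-invariant (keep {a = a} r) f R = ∼-invariant r (f ∘ (a ∷_)) (R ∘ Move-∷ a)

-- Both tuples reduce to the same normal form.
odd-set-determines : ∀ {n} (f : Tuple n → Z3) → (∀ {x y} → Move x y → f x ≡ f y) →
                     ∀ x y → odd-set x ≡ odd-set y → f x ≡ f y
odd-set-determines f R x y e =
  let (x′ , C , r) = canonical x
      (y′ , D , s) = canonical y
  in trans (∼-invariant r f R) (trans (cong f (Canonical-unique (subst (λ S → Canonical S x′) e C) D)) (sym (∼-invariant s f R)))

-- The length fixes the parity of the odd set, so the key determines the odd set. Hence `f` is a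
-- function of the key, and interpolation on representatives supplies the coefficients.
move-invariant⇒form : ∀ {n} (f : Tuple (suc (suc n)) → Z3) → (∀ {x y} → Move x y → f x ≡ f y) →
                      ∃ λ a → ∃ λ b → ∃ λ c → ∃ λ d → HasForm (suc (suc n)) f a b c d
move-invariant⇒form {n} f R =
  let (a , b , c) = coefficients (f ∘ rep)
  in a , b , c , f (rep nothing) , val⇒form {a = a} {b} {c} {f (rep nothing)} λ x → trans
       (odd-set-determines f R x (rep (key (odd-set x)))
         (key-injective _ _ (trans (parity-odd-set x) (sym (parity-odd-set (rep (key (odd-set x))))))
                            (sym (proj₂ (key-realized n (key (odd-set x)))))))
       (sym (interpolate (f ∘ rep) (key (odd-set x))))
  where
  rep : Maybe Z3 → Tuple (suc (suc n))
  rep k = proj₁ (key-realized n k)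

-- Good pairs imply invariance under transpositions.

module _ {n : ℕ} (F : (Fin n → Z3) → Z3) (F-cong : ∀ {x y} → (∀ m → x m ≡ y m) → F x ≡ F y) where
  open Minors F F-cong

  module Exchange (good : ∀ {i j} → i ≢ j → Good i j) {i j l m : Fin n} (i≢j : i ≢ j) (l≢i : l ≢ i) (l≢j : l ≢ j)
                  (m≢i : m ≢ i) (m≢j : m ≢ j) (m≢l : m ≢ l) where

    open Coordinates (lookup (i ∷ j ∷ l ∷ m ∷ [])) (lookup-injective
      (distinct₄ i≢j (l≢i ∘ sym) (m≢i ∘ sym) (l≢j ∘ sym) (m≢j ∘ sym) (m≢l ∘ sym)) _ _)

    il = at-good 0F 2F (good (l≢i ∘ sym))
    jl = at-good 1F 2F (good (l≢j ∘ sym))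
    im = at-good 0F 3F (good (m≢i ∘ sym))
    jm = at-good 1F 3F (good (m≢j ∘ sym))
    lm = at-good 2F 3F (good (m≢l ∘ sym))

    -- Two of the four entries coincide, and a good pair of equal entries can take any common value.
    -- If `z = a`, set positions 0 and 2 to `b`, then positions 1 and 2 to `a`.
    at-swap : ∀ o a b z w → at o (a ∷ b ∷ z ∷ w ∷ []) ≡ at o (b ∷ a ∷ z ∷ w ∷ [])
    at-swap o a b z w with coincidence a b z w
    ... | inj₁ refl = refl
    ... | inj₂ (inj₁ refl) = trans (il o _ b refl) (jl o _ a refl)
    ... | inj₂ (inj₂ (inj₁ refl)) = trans (jl o _ a refl) (il o _ b refl)
    ... | inj₂ (inj₂ (inj₂ (inj₁ refl))) = trans (im o _ b refl) (jm o _ a refl)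
    ... | inj₂ (inj₂ (inj₂ (inj₂ (inj₁ refl)))) = trans (jm o _ a refl) (im o _ b refl)
    -- The spare pair is lent the value `a`, used as in the case `z = a`, and then restored to `z`.
    ... | inj₂ (inj₂ (inj₂ (inj₂ (inj₂ refl)))) = trans (lm o _ a refl)
            (trans (il o _ b refl) (trans (jl o _ a refl) (lm o _ z refl)))

    exchange : ∀ {x y} → x i ≡ y j → x j ≡ y i → x ≈[ (λ k → k ≡ i ⊎ k ≡ j) ] y → F x ≡ F y
    exchange {x} {y} eᵢ eⱼ r = trans (at-self {x} {x i ∷ x j ∷ x l ∷ x m ∷ []} λ { 0F → refl ; 1F → refl ; 2F → refl ; 3F → refl })
      (trans (at-swap x (x i) (x j) (x l) (x m))
      (trans (at-cong _ λ k k∉ → ≈-at r λ { (inj₁ e) → k∉ 0F (sym e) ; (inj₂ e) → k∉ 1F (sym e) })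
      (sym (at-self λ { 0F → sym eⱼ ; 1F → sym eᵢ
                      ; 2F → sym (≈-at r λ { (inj₁ e) → l≢i e ; (inj₂ e) → l≢j e })
                      ; 3F → sym (≈-at r λ { (inj₁ e) → m≢i e ; (inj₂ e) → m≢j e }) }))))

-- From functions on tuples to functions on assignments.

lookup-ext : ∀ {n} {x y : Tuple n} → (∀ m → lookup x m ≡ lookup y m) → x ≡ y
lookup-ext {x = x} {y} e = trans (sym (tabulate∘lookup x)) (trans (tabulate-cong e) (tabulate∘lookup y))

tabulate-set : ∀ {n l} {X Y : Fin n → Z3} → X ≈[ _≡ l ] Y → tabulate X [ l ]≔ Y l ≡ tabulate Y
tabulate-set {l = l} {X} {Y} r = lookup-ext λ m → go m (m ≟ l)
  where
  go : ∀ m → Dec (m ≡ l) → lookup (tabulate X [ l ]≔ Y l) m ≡ lookup (tabulate Y) m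
  go m (yes refl) = trans (lookup∘update m (tabulate X) (Y m)) (sym (lookup∘tabulate Y m))
  go m (no m≢l) = trans (lookup∘update′ m≢l (tabulate X) (Y l))
    (trans (lookup∘tabulate X m) (trans (≈-at r m≢l) (sym (lookup∘tabulate Y m))))

module _ {n} (f : Tuple n → Z3) where

  F : (Fin n → Z3) → Z3
  F = f ∘ tabulate

  F-cong : ∀ {x y} → (∀ m → x m ≡ y m) → F x ≡ F y
  F-cong e = cong f (tabulate-cong e)

  F-lookup : ∀ x → F (lookup x) ≡ f x
  F-lookup x = cong f (tabulate∘lookup x)

  private module G = Minors F F-cong

  good⇒move-invariant : 4 ≤ n → (∀ {i j} → i ≢ j → G.Good i j) → ∀ {x y} → Move x y → f x ≡ f y
  good⇒move-invariant 4≤n good {x} {y} (i , j , i≢j , off , inj₂ (ex , ey)) =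
    trans (sym (F-lookup x)) (trans (good i≢j ex ey off) (F-lookup y))
  good⇒move-invariant 4≤n good {x} {y} (i , j , i≢j , off , inj₁ (eᵢ , eⱼ)) =
    let (l , l≢i , l≢j , _) = fresh 4≤n i j j
        (m , m≢i , m≢j , m≢l) = fresh 4≤n i j l
    in trans (sym (F-lookup x))
         (trans (Exchange.exchange F F-cong good i≢j l≢i l≢j m≢i m≢j m≢l eᵢ eⱼ off) (F-lookup y))

  essential⇒alive : ∀ {l} → Essential f l → ¬ G.Dead l
  essential⇒alive {l} (x , a , ne) dead = ne (trans (sym (F-lookup x)) (trans (dead r) (F-lookup (x [ l ]≔ a))))
    where
    r : lookup x ≈[ _≡ l ] lookup (x [ l ]≔ a)
    r m with m ≟ l
    ... | yes m≡l = inj₁ m≡l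
    ... | no m≢l = inj₂ (sym (lookup∘update′ m≢l x a))

  -- The quantification over assignments reduces to a finite search for a tuple and a new entry at
  -- `l`.
  indep? : ∀ i j l → Dec (G.Indep i j l)
  indep? i j l with ∃Tuple? n (λ x → any? λ a → lookup x i ≟ lookup x j ×-dec
                     lookup (x [ l ]≔ a) i ≟ lookup (x [ l ]≔ a) j ×-dec ¬? (f x ≟ f (x [ l ]≔ a)))
  ... | yes (x , a , ex , ey , ne) = no λ I → ne (trans (sym (F-lookup x)) (trans (I ex ey r) (F-lookup (x [ l ]≔ a))))
    where
    r : lookup x ≈[ _≡ l ] lookup (x [ l ]≔ a)
    r m with m ≟ l
    ... | yes m≡l = inj₁ m≡l
    ... | no m≢l = inj₂ (sym (lookup∘update′ m≢l x a))
  ... | no none = yes λ {X} {Y} eX eY r → trans (decidable-stable (_ ≟ _) λ ne → none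
            (tabulate X , Y l , at-tab {X} eX , subst (λ y → lookup y i ≡ lookup y j) (sym (tabulate-set r)) (at-tab {Y} eY) , ne))
          (cong f (tabulate-set r))
    where
    at-tab : ∀ {X} → X i ≡ X j → lookup (tabulate X) i ≡ lookup (tabulate X) j
    at-tab {X} e = trans (lookup∘tabulate X i) (trans e (sym (lookup∘tabulate X j)))

  -- On `X i = X j` the function equals its minor, which ignores the entry at `i`. Letting that
  -- entry vary too covers `l = j`, where the conclusion is `Good i j`.
  inessential-minor : ∀ {i j l} → i ≢ j → l ≢ i → ¬ Essential (minor f i j) l →
                      G.Invariant i j (λ m → m ≡ i ⊎ m ≡ l)
  inessential-minor {i} {j} {l} i≢j l≢i ¬ess {X} {Y} eX eY r = begin
      F X                                      ≡⟨ cong f (sym (lookup-ext λ m → go₁ m (m ≟ i))) ⟩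
      minor f i j (tabulate X)                 ≡⟨ decidable-stable (_ ≟ _) (λ ne → ¬ess (tabulate X , Y l , ne)) ⟩
      minor f i j (tabulate X [ l ]≔ Y l)      ≡⟨ cong f (lookup-ext λ m → go₂ m (m ≟ i)) ⟩
      F Y                                      ∎
    where
    open ≡-Reasoning
    go₁ : ∀ m → Dec (m ≡ i) → lookup (tabulate X [ i ]≔ lookup (tabulate X) j) m ≡ lookup (tabulate X) m
    go₁ m (yes refl) = trans (lookup∘update m (tabulate X) _)
      (trans (lookup∘tabulate X j) (trans (sym eX) (sym (lookup∘tabulate X m))))
    go₁ m (no m≢i) = lookup∘update′ m≢i (tabulate X) _
    at-l : ∀ m → m ≢ i → Dec (m ≡ l) → lookup (tabulate X [ l ]≔ Y l) m ≡ Y m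
    at-l m _ (yes refl) = lookup∘update m (tabulate X) (Y m)
    at-l m m≢i (no m≢l) = trans (lookup∘update′ m≢l (tabulate X) (Y l))
      (trans (lookup∘tabulate X m) (≈-at r λ { (inj₁ e) → m≢i e ; (inj₂ e) → m≢l e }))
    go₂ : ∀ m → Dec (m ≡ i) → lookup (tabulate X [ l ]≔ Y l [ i ]≔ lookup (tabulate X [ l ]≔ Y l) j) m ≡ lookup (tabulate Y) m
    go₂ m (yes refl) = trans (lookup∘update m (tabulate X [ l ]≔ Y l) _)
      (trans (at-l j (i≢j ∘ sym) (j ≟ l)) (trans (sym eY) (sym (lookup∘tabulate Y m))))
    go₂ m (no m≢i) = trans (lookup∘update′ m≢i (tabulate X [ l ]≔ Y l) _) (trans (at-l m m≢i (m ≟ l)) (sym (lookup∘tabulate Y m)))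

  inessential⇒loses : ∀ {i j l} → i ≢ j → l ≢ i → ¬ Essential (minor f i j) l → G.Loses i j
  inessential⇒loses {i} {j} {l} i≢j l≢i ¬ess with l ≟ j
  ... | yes refl = inj₁ (inessential-minor i≢j l≢i ¬ess)
  ... | no l≢j = inj₂ (l , l≢i , l≢j , λ ex ey r → inessential-minor i≢j l≢i ¬ess ex ey (Sum.map₁ inj₂ ∘ r))

-- Essential variables of functions of the odd set.

⊕-cancel : ∀ S T → S ⊕ (S ⊕ T) ≡ T
⊕-cancel S T = trans (sym (⊕-assoc S S T)) (trans (cong (_⊕ T) (⊕-self S)) (⊕-identityˡ T))

⊕-left-comm : ∀ S T U → S ⊕ (T ⊕ U) ≡ T ⊕ (S ⊕ U)
⊕-left-comm S T U = trans (sym (⊕-assoc S T U)) (trans (cong (_⊕ U) (⊕-comm S T)) (⊕-assoc T S U))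

odd-set-update : ∀ {n} (x : Tuple n) i a → odd-set (x [ i ]≔ a) ≡ ⁅ a ⁆ ⊕ (⁅ lookup x i ⁆ ⊕ odd-set x)
odd-set-update (b ∷ x) zero a = cong (⁅ a ⁆ ⊕_) (sym (⊕-cancel ⁅ b ⁆ (odd-set x)))
odd-set-update (b ∷ x) (suc i) a = begin
  ⁅ b ⁆ ⊕ odd-set (x [ i ]≔ a)                    ≡⟨ cong (⁅ b ⁆ ⊕_) (odd-set-update x i a) ⟩
  ⁅ b ⁆ ⊕ (⁅ a ⁆ ⊕ (⁅ lookup x i ⁆ ⊕ odd-set x))  ≡⟨ ⊕-left-comm ⁅ b ⁆ ⁅ a ⁆ _ ⟩
  ⁅ a ⁆ ⊕ (⁅ b ⁆ ⊕ (⁅ lookup x i ⁆ ⊕ odd-set x))  ≡⟨ cong (⁅ a ⁆ ⊕_) (⊕-left-comm ⁅ b ⁆ ⁅ lookup x i ⁆ _) ⟩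
  ⁅ a ⁆ ⊕ (⁅ lookup x i ⁆ ⊕ (⁅ b ⁆ ⊕ odd-set x))  ∎
  where open ≡-Reasoning

-- Exchanging the entries `i` and `l` of the witness preserves its odd set, and changing entry `l`
-- afterwards has the effect of changing entry `i` before.
essential-transfer : ∀ {n} (φ : Subset 3 → Z3) {i l : Fin n} → Essential (φ ∘ odd-set) i → Essential (φ ∘ odd-set) l
essential-transfer φ {i} {l} (x , a , ne) with l ≟ i
... | yes refl = x , a , ne
... | no l≢i = z , a , λ e → ne (trans (cong φ (sym same)) (trans e (cong φ updated)))
  where
  open ≡-Reasoning
  y z : Tuple _
  y = x [ i ]≔ lookup x l
  z = y [ l ]≔ lookup x i
  same : odd-set z ≡ odd-set x
  same = begin
    odd-set z                                          ≡⟨ odd-set-update y l (lookup x i) ⟩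
    ⁅ lookup x i ⁆ ⊕ (⁅ lookup y l ⁆ ⊕ odd-set y)      ≡⟨ cong₂ (λ b S → ⁅ lookup x i ⁆ ⊕ (⁅ b ⁆ ⊕ S))
                                                            (lookup∘update′ l≢i x _) (odd-set-update x i (lookup x l)) ⟩
    ⁅ lookup x i ⁆ ⊕ (⁅ lookup x l ⁆ ⊕ (⁅ lookup x l ⁆ ⊕ (⁅ lookup x i ⁆ ⊕ odd-set x)))
                                                       ≡⟨ cong (⁅ lookup x i ⁆ ⊕_) (⊕-cancel ⁅ lookup x l ⁆ _) ⟩
    ⁅ lookup x i ⁆ ⊕ (⁅ lookup x i ⁆ ⊕ odd-set x)      ≡⟨ ⊕-cancel ⁅ lookup x i ⁆ _ ⟩
    odd-set x                                          ∎
  updated : odd-set (z [ l ]≔ a) ≡ odd-set (x [ i ]≔ a)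
  updated = begin
    odd-set (z [ l ]≔ a)                      ≡⟨ odd-set-update z l a ⟩
    ⁅ a ⁆ ⊕ (⁅ lookup z l ⁆ ⊕ odd-set z)      ≡⟨ cong₂ (λ b S → ⁅ a ⁆ ⊕ (⁅ b ⁆ ⊕ S)) (lookup∘update l y _) same ⟩
    ⁅ a ⁆ ⊕ (⁅ lookup x i ⁆ ⊕ odd-set x)      ≡⟨ sym (odd-set-update x i a) ⟩
    odd-set (x [ i ]≔ a)                      ∎

inessential⇒constant : ∀ {n} (g : Tuple n → Z3) → (∀ i → ¬ Essential g i) → ∀ x y → g x ≡ g y
inessential⇒constant g none [] [] = refl
inessential⇒constant g none (a ∷ x) (b ∷ y) = trans
  (decidable-stable (_ ≟ _) λ ne → none zero (a ∷ x , b , ne))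
  (inessential⇒constant (g ∘ (b ∷_)) (λ { i (z , d , ne) → none (suc i) (b ∷ z , d , ne) }) x y)

nonconstant⇒essential : ∀ {n} (φ : Subset 3 → Z3) → ¬ (∀ x y → φ (odd-set {n} x) ≡ φ (odd-set y)) →
                        ∀ l → Essential (φ ∘ odd-set {n}) l
nonconstant⇒essential φ ¬const l with any? (essential? (φ ∘ odd-set))
... | yes (_ , e) = essential-transfer φ e
... | no none = contradiction (inessential⇒constant (φ ∘ odd-set) λ i e → none (i , e)) ¬const

minor-drops : ∀ {n} (f : Tuple n → Z3) i j → i ≢ j → ¬ Essential (minor f i j) i
minor-drops f i j i≢j (x , a , ne) = ne (cong f (sym
  (trans (cong ((x [ i ]≔ a) [ i ]≔_) (lookup∘update′ (i≢j ∘ sym) x a)) ([]≔-idempotent x i))))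

-- In the minor the positions `i` and `j` carry the same value, which cancels from the odd set.
minor-drops-both : ∀ {n} (φ : Subset 3 → Z3) (f : Tuple n → Z3) → (∀ x → f x ≡ φ (odd-set x)) →
                   ∀ i j → i ≢ j → ¬ Essential (minor f i j) j
minor-drops-both φ f h i j i≢j (x , a , ne) = ne (trans (h _) (trans (cong φ same) (sym (h _))))
  where
  open ≡-Reasoning
  P = odd-set x
  same : odd-set (x [ i ]≔ lookup x j) ≡ odd-set (x [ j ]≔ a [ i ]≔ lookup (x [ j ]≔ a) j)
  same = sym (begin
    odd-set (x [ j ]≔ a [ i ]≔ lookup (x [ j ]≔ a) j)
      ≡⟨ odd-set-update (x [ j ]≔ a) i _ ⟩
    ⁅ lookup (x [ j ]≔ a) j ⁆ ⊕ (⁅ lookup (x [ j ]≔ a) i ⁆ ⊕ odd-set (x [ j ]≔ a))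
      ≡⟨ cong₂ (λ b d → ⁅ b ⁆ ⊕ (⁅ d ⁆ ⊕ odd-set (x [ j ]≔ a))) (lookup∘update j x a) (lookup∘update′ i≢j x a) ⟩
    ⁅ a ⁆ ⊕ (⁅ lookup x i ⁆ ⊕ odd-set (x [ j ]≔ a))
      ≡⟨ cong (λ S → ⁅ a ⁆ ⊕ (⁅ lookup x i ⁆ ⊕ S)) (odd-set-update x j a) ⟩
    ⁅ a ⁆ ⊕ (⁅ lookup x i ⁆ ⊕ (⁅ a ⁆ ⊕ (⁅ lookup x j ⁆ ⊕ P)))
      ≡⟨ cong (⁅ a ⁆ ⊕_) (⊕-left-comm ⁅ lookup x i ⁆ ⁅ a ⁆ _) ⟩
    ⁅ a ⁆ ⊕ (⁅ a ⁆ ⊕ (⁅ lookup x i ⁆ ⊕ (⁅ lookup x j ⁆ ⊕ P)))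
      ≡⟨ ⊕-cancel ⁅ a ⁆ _ ⟩
    ⁅ lookup x i ⁆ ⊕ (⁅ lookup x j ⁆ ⊕ P)
      ≡⟨ ⊕-left-comm ⁅ lookup x i ⁆ ⁅ lookup x j ⁆ P ⟩
    ⁅ lookup x j ⁆ ⊕ (⁅ lookup x i ⁆ ⊕ P)
      ≡⟨ sym (odd-set-update x i (lookup x j)) ⟩
    odd-set (x [ i ]≔ lookup x j) ∎)

-- Counting essential variables.

module _ {n} (g : Tuple n → Z3) where

  -- Ess g is select (essential? g) by definition.
  all-essential⇒ess : (∀ l → Essential g l) → ess g ≡ n
  all-essential⇒ess h = ≤-antisym
    (∣p∣≤n (Ess g))
    (≤-trans (≤-reflexive (sym (∣⊤∣≡n n))) (p⊆q⇒∣p∣≤∣q∣ {p = full} λ {l} _ → ∈-select (essential? g) (h l)))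

  co-singleton : ∀ i → ∣ ∁ {n} ⁅ i ⁆ ∣ ≡ n ∸ 1
  co-singleton i = trans (∣∁p∣≡n∸∣p∣ ⁅ i ⁆) (cong (n ∸_) (∣⁅x⁆∣≡1 i))

  avoids : ∀ {i} → ¬ Essential g i → Ess g ⊆ ∁ ⁅ i ⁆
  avoids ¬i {l} l∈ = x∉p⇒x∈∁p λ l∈i → ¬i (subst (Essential g) (x∈⁅y⁆⇒x≡y _ l∈i) (select-∈ (essential? g) l∈))

  inessential⇒1≤ : ∀ {i} → ¬ Essential g i → 1 ≤ n ∸ ess g
  inessential⇒1≤ {i} ¬i = m+n≤o⇒m≤o∸n 1 (≤-trans (p⊂q⇒∣p∣<∣q∣ {p = Ess g} {q = full}
    ((λ _ → ∈⊤) , i , ∈⊤ , λ i∈ → ¬i (select-∈ (essential? g) i∈))) (≤-reflexive (∣⊤∣≡n n)))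

  inessential²⇒2≤ : ∀ {i j} → i ≢ j → ¬ Essential g i → ¬ Essential g j → 2 ≤ n ∸ ess g
  inessential²⇒2≤ {i} {j} i≢j ¬i ¬j = m+n≤o⇒m≤o∸n 2 (go n (≤-trans (p⊂q⇒∣p∣<∣q∣
      (avoids ¬i , j , x∉p⇒x∈∁p (λ j∈ → i≢j (sym (x∈⁅y⁆⇒x≡y _ j∈))) , λ j∈ → ¬j (select-∈ (essential? g) j∈)))
      (≤-reflexive (co-singleton i))))
    where
    -- The case `k = 0` is void, since the truncated difference `0 ∸ 1` is `0`.
    go : ∀ k {m} → m < k ∸ 1 → suc (suc m) ≤ k
    go (suc k) m<k = s≤s m<k

  -- Otherwise all indices other than `i` are essential, and at most one variable is missing.
  2≤⇒inessential : ∀ i → 2 ≤ n ∸ ess g → ∃ λ l → l ≢ i × ¬ Essential g l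
  2≤⇒inessential i 2≤ with any? (λ l → ¬? (l ≟ i) ×-dec ¬? (essential? g l))
  ... | yes h = h
  ... | no none = contradiction (≤-trans 2≤ (m≤n+o⇒m∸n≤o n (ess g) bound)) λ { (s≤s ()) }
    where
    others : ∁ ⁅ i ⁆ ⊆ Ess g
    others {l} l∈ = ∈-select (essential? g) (decidable-stable (essential? g l) λ ¬l →
      none (l , (λ { refl → x∈∁p⇒x∉p l∈ (x∈⁅x⁆ l) }) , ¬l))
    bound : n ≤ ess g ℕ.+ 1
    bound = ≤-trans (m≤n+m∸n n 1) (≤-trans (s≤s (≤-trans (≤-reflexive (sym (co-singleton i))) (p⊆q⇒∣p∣≤∣q∣ others)))
              (≤-reflexive (+-comm 1 (ess g))))

subset-bound : ∀ {n} (E : Subset (suc (suc n))) → (∀ l → suc (suc l) ∈ E) → n ≤ ∣ E ∣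
subset-bound {n} (a ∷ b ∷ E) h = ≤-trans (≤-reflexive (sym (∣⊤∣≡n n)))
  (≤-trans (p⊆q⇒∣p∣≤∣q∣ {p = full} λ {l} _ → drop-there (drop-there (h l)))
  (≤-trans (∣p∣≤∣x∷p∣ b E) (∣p∣≤∣x∷p∣ a (b ∷ E))))

-- The gap as an attained minimum.

minimum-∈ : ∀ {v} L → v ∈ˡ L → minimum L ∈ˡ L
minimum-∈ (x List.∷ xs) _ = [ here , there ]′ (foldr-selective ⊓-sel x xs)

minimum-≤ : ∀ {v} L → v ∈ˡ L → minimum L ≤ v
minimum-≤ (x List.∷ xs) v∈ = go xs v∈
  where
  go : ∀ {v} xs → v ∈ˡ (x List.∷ xs) → foldr _⊓_ x xs ≤ v
  go List.[] (here refl) = ≤-refl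
  go (y List.∷ xs) (here refl) = ≤-trans (m⊓n≤n y _) (go xs (here refl))
  go (y List.∷ xs) (there (here refl)) = m⊓n≤m y _
  go (y List.∷ xs) (there (there v∈)) = ≤-trans (m⊓n≤n y _) (go xs (there v∈))

module _ {n} (f : Tuple n → Z3) where

  entry : Fin n → Fin n → List ℕ
  entry i j = if does (i ≟ j) then List.[]
    else (if does (essential? f i) ∧ does (essential? f j) then List.[ ess f ∸ ess (minor f i j) ] else List.[])

  ∈-gapValues : ∀ {i j} → i ≢ j → Essential f i → Essential f j → (ess f ∸ ess (minor f i j)) ∈ˡ gapValues f
  ∈-gapValues {i} {j} i≢j eᵢ eⱼ =
    ∈-concatMap⁺ _ (lose (∈-allFin i) (∈-concatMap⁺ (entry i) (lose (∈-allFin j) mem)))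
    where
    mem : (ess f ∸ ess (minor f i j)) ∈ˡ entry i j
    mem rewrite dec-false (i ≟ j) i≢j | dec-true (essential? f i) eᵢ | dec-true (essential? f j) eⱼ = here refl

  gapValues-∈ : ∀ {v} → v ∈ˡ gapValues f → ∃ λ i → ∃ λ j → i ≢ j × v ≡ ess f ∸ ess (minor f i j)
  gapValues-∈ {v} v∈ =
    let (i , _ , v∈ᵢ) = find (∈-concatMap⁻ (λ i → concatMap (entry i) (allFin n)) {allFin n} v∈)
        (j , _ , v∈ⱼ) = find (∈-concatMap⁻ (entry i) {allFin n} v∈ᵢ)
    in i , j , mem i j v∈ⱼ
    where
    mem : ∀ i j → v ∈ˡ entry i j → i ≢ j × v ≡ ess f ∸ ess (minor f i j)
    mem i j v∈ with i ≟ j | does (essential? f i) ∧ does (essential? f j)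
    mem i j () | yes _ | _
    mem i j (here e) | no i≢j | true = i≢j , e
    mem i j () | no _ | false

-- The gap of a function with all variables essential.

Form : ∀ n → (Tuple n → Z3) → Set
Form n f = Σ Z3 (λ a → Σ Z3 (λ b → Σ Z3 (λ c → Σ Z3 (λ d → HasForm n f a b c d))))

module _ {m} (f : Tuple (4 ℕ.+ m) → Z3) (ess-all : ∀ i → Essential f i) where

  private n = 4 ℕ.+ m

  loss : Fin n → Fin n → ℕ
  loss i j = n ∸ ess (minor f i j)

  ess-f : ess f ≡ n
  ess-f = all-essential⇒ess f ess-all

  gap-attained : ∃ λ i → ∃ λ j → i ≢ j × gap f ≡ loss i j
  gap-attained =
    -- The pair of the first two variables shows that the list is nonempty, so the default value of
    -- `minimum` does not arise.
    let (i , j , i≢j , e) = gapValues-∈ f (minimum-∈ (gapValues f) (∈-gapValues f {0F} {1F} (λ ()) (ess-all _) (ess-all _)))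
    in i , j , i≢j , trans e (cong (_∸ ess (minor f i j)) ess-f)

  gap≤loss : ∀ {i j} → i ≢ j → gap f ≤ loss i j
  gap≤loss {i} {j} i≢j = ≤-trans (minimum-≤ (gapValues f) (∈-gapValues f i≢j (ess-all i) (ess-all j)))
    (≤-reflexive (cong (_∸ ess (minor f i j)) ess-f))

  1≤gap : 1 ≤ gap f
  1≤gap = let (i , j , i≢j , e) = gap-attained in
    ≤-trans (inessential⇒1≤ (minor f i j) (minor-drops f i j i≢j)) (≤-reflexive (sym e))

  -- The inequality serves the equivalence and, contraposed, bounds the gap by 1 when no such form
  -- exists.
  2≤gap⇒form : 2 ≤ gap f → Form n f
  2≤gap⇒form 2≤gap = move-invariant⇒form f (good⇒move-invariant f 4≤n
      (Minors.Main.all-good (F f) (F-cong f) 4≤n loses (λ l → essential⇒alive f (ess-all l)) (indep? f)))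
    where
    4≤n : 4 ≤ n
    4≤n = s≤s (s≤s (s≤s (s≤s z≤n)))
    loses : ∀ {i j} → i ≢ j → Minors.Loses (F f) (F-cong f) i j
    loses {i} {j} i≢j =
      let (l , l≢i , ¬ess) = 2≤⇒inessential (minor f i j) i (≤-trans 2≤gap (gap≤loss i≢j))
      in inessential⇒loses f i≢j l≢i ¬ess

  -- Identified variables cancel, so every minor loses at least two. The minor on the first two
  -- variables loses no others, being the same function of the odd set of the remaining entries.
  key-function⇒gap≡2 : (ψ : Maybe Z3 → Z3) → (∀ x → f x ≡ ψ (key (odd-set x))) → gap f ≡ 2
  key-function⇒gap≡2 ψ h = ≤-antisym gap≤2 2≤gap
    where
    φ : Subset 3 → Z3
    φ = ψ ∘ key
    2≤gap : 2 ≤ gap f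
    2≤gap = let (i , j , i≢j , e) = gap-attained in
      ≤-trans (inessential²⇒2≤ (minor f i j) i≢j (minor-drops f i j i≢j) (minor-drops-both φ f h i j i≢j))
              (≤-reflexive (sym e))
    -- At least two entries remain, enough to realize every key; constancy there would make `f`
    -- itself constant.
    nonconstant : ¬ (∀ (x y : Tuple (2 ℕ.+ m)) → φ (odd-set x) ≡ φ (odd-set y))
    nonconstant const with ess-all 0F
    ... | x , s , ne = ne (trans (h x) (trans (same (key (odd-set x)) (key (odd-set y))) (sym (h y))))
      where
      y = x [ 0F ]≔ s
      same : ∀ k k′ → ψ k ≡ ψ k′
      same k k′ with key-realized m k | key-realized m k′
      ... | u , refl | v , refl = const u v
    essential-rest : ∀ l → Essential (minor f 0F 1F) (suc (suc l))
    essential-rest l with nonconstant⇒essential φ nonconstant l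
    ... | z , s , ne = 0F ∷ 0F ∷ z , s , λ e → ne (trans (sym (value z)) (trans e (value (z [ l ]≔ s))))
      where
      value : ∀ z → f (0F ∷ 0F ∷ z) ≡ φ (odd-set z)
      value z = trans (h _) (cong φ (⊕-cancel _ _))
    gap≤2 : gap f ≤ 2
    gap≤2 = ≤-trans (gap≤loss {0F} {1F} (λ ())) (m≤n+o⇒m∸n≤o n (ess (minor f 0F 1F))
      (≤-trans (s≤s (s≤s (subset-bound (Ess (minor f 0F 1F)) λ l → ∈-select (essential? (minor f 0F 1F)) (essential-rest l))))
               (≤-reflexive (+-comm 2 _))))

  form⇒gap≡2 : Form n f → gap f ≡ 2
  form⇒gap≡2 (a , b , c , d , form) = key-function⇒gap≡2 (val a b c d) (form⇒val {a = a} {b} {c} {d} form)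

theorem5p1 : (n : ℕ) → 4 ≤ n → (f : Tuple n → Z3) → (∀ (i : Fin n) → Essential f i) →
    (gap f ≡ 2 ⇔ Σ Z3 (λ a → Σ Z3 (λ b → Σ Z3 (λ c → Σ Z3 (λ d → HasForm n f a b c d)))))
    × (∀ a b c d a′ b′ c′ d′ → HasForm n f a b c d → HasForm n f a′ b′ c′ d′ →
         (a ≡ a′) × (b ≡ b′) × (c ≡ c′) × (d ≡ d′))
    × (¬ Σ Z3 (λ a → Σ Z3 (λ b → Σ Z3 (λ c → Σ Z3 (λ d → HasForm n f a b c d)))) → gap f ≡ 1)
theorem5p1 n@(suc (suc (suc (suc m)))) (s≤s (s≤s (s≤s (s≤s z≤n)))) f ess-all =
    mk⇔ (λ e → 2≤gap⇒form f ess-all (≤-reflexive (sym e))) (form⇒gap≡2 f ess-all) ,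
    unique ,
    λ none → ≤-antisym (≮⇒≥ (none ∘ 2≤gap⇒form f ess-all)) (1≤gap f ess-all)
  where
  unique : ∀ a b c d a′ b′ c′ d′ → HasForm n f a b c d → HasForm n f a′ b′ c′ d′ →
           (a ≡ a′) × (b ≡ b′) × (c ≡ c′) × (d ≡ d′)
  unique a b c d a′ b′ c′ d′ p q = val-injective a b c d a′ b′ c′ d′ go
    where
    -- Every key is realized by a tuple of length `n`, so `f` fixes `val` at all four keys.
    go : ∀ k → val a b c d k ≡ val a′ b′ c′ d′ k
    go k with key-realized (2 ℕ.+ m) k
    ... | x , refl = trans (sym (form⇒val {a = a} {b} {c} {d} p x)) (form⇒val {a = a′} {b′} {c′} {d′} q x)
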